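{- Let $G$ be a finite abelian group, and let $A$, $B$ and $S$ be non-empty subsets of $G$. Then $$|A\dotplus_S B|\geq\min\{|A|+|B|-3|S|,\ p(G)\}.$$
   Context: For subsets $A,B,S$ of an abelian group $G$ (written additively), the generalized restricted sumset is $A\dotplus_S B:=\{a+b:\ a\in A,\ b\in B,\ a-b\notin S\}$. For a finite group $G$, $p(G)$ denotes the least prime factor of $|G|$. -}

module Defs where

open import Data.Nat using (ℕ)
open import Data.Fin using (Fin)
open import Data.Fin.Properties using (any?; _≟_)
open import Data.Fin.Subset using (Subset; _∈_; _∉_)
open import Data.Fin.Subset.Properties using (_∈?_)
open import Data.Product using (_×_; ∃)
open import Data.Vec using (tabulate)
open import Relation.Binary.PropositionalEquality using (_≡_)
open import Relation.Nullary using (¬?)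
open import Relation.Nullary.Decidable using (⌊_⌋; _×-dec_)

-- A finite abelian group of order n, with carrier Fin n (every finite
-- abelian group is isomorphic to one of this form).
record FiniteAbelianGroup (n : ℕ) : Set where
  infixl 6 _+_ _-_
  field
    _+_ : Fin n → Fin n → Fin n
    0# : Fin n
    -_ : Fin n → Fin n
    +-assoc : ∀ x y z → (x + y) + z ≡ x + (y + z)
    +-comm : ∀ x y → x + y ≡ y + x
    +-identityˡ : ∀ x → 0# + x ≡ x
    +-inverseˡ : ∀ x → (- x) + x ≡ 0#
  _-_ : Fin n → Fin n → Fin n
  x - y = x + (- y)

restrictedSumset : ∀ {n} → FiniteAbelianGroup n → Subset n → Subset n → Subset n → Subset n
restrictedSumset G A B S = tabulate λ c →
  ⌊ any? (λ a → any? (λ b →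
      (a ∈? A) ×-dec (b ∈? B) ×-dec ((a + b) ≟ c) ×-dec ¬? ((a - b) ∈? S))) ⌋
  where open FiniteAbelianGroup G

module Submission where

-- G is exhausted by a chain of subgroups H ⊂ K with K/H of prime order q ≥ p, and
-- the bound p ≤ |C| or |A| + |B| ≤ |C| + max(1, 3|S|), for C covering the restricted
-- sumset, is carried from subsets of cosets of H to subsets of cosets of K.
-- Let f, g, σ, T be the fibre sizes of A, B, S, C over K/H = ℤ/q, where A meets at
-- most as many classes as B, and let i₀ maximise f, with α = f i₀. The classes
-- i₀ + j with g j > 0 are distinct, and the bound for H controls their fibres of C.
-- The number of all classes met by C is at least #{f ≥ α} + #{g > 0} - 1 - 2 #{σ ≥ α}
-- by the restricted sumset theorem in ℤ/q, because T (i + j) > 0 whenever f i ≥ α,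
-- g j > 0 and σ (i - j) < α. Adding up Σ T = #{T > 0} + Σ (T ∸ 1) gives the bound
-- for K. The theorem in ℤ/q is proved by the polynomial method.

open import Defs
open import Algebra.Bundles using (AbelianGroup; CommutativeRing; RawRing)
open import Algebra.Core using (Op₁; Op₂)
import Algebra.Solver.Ring
import Algebra.Solver.Ring.AlmostCommutativeRing as ACR
open import Algebra.Structures using (IsCommutativeRing)
open import Data.Bool using (if_then_else_; true; false)
open import Data.Empty using (⊥; ⊥-elim)
open import Data.Fin as Fin using (Fin; toℕ; zero; suc)
open import Data.Fin.Permutation using (permutation)
import Data.Fin.Properties as Fin
open import Data.Fin.Subset using (Subset; ∣_∣)
import Data.Fin.Subset as Subset
open import Data.Fin.Subset.Properties using (_∈?_)
open import Data.List using (List; []; _∷_; _++_; allFin; filter; length; map; tabulate; take; upTo)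
open import Data.List.Membership.Propositional using (_∈_)
open import Data.List.Membership.Propositional.Properties
  using (∈-++⁺ˡ; ∈-++⁺ʳ; ∈-++⁻; ∈-allFin; ∈-filter⁺; ∈-filter⁻; ∈-length; ∈-map⁺; ∈-map⁻; ∈-upTo⁺; ∈-∃++)
open import Data.List.Properties using (length-++; length-map; length-take; length-upTo)
open import Data.List.Relation.Unary.All as All using (All; []; _∷_)
open import Data.List.Relation.Unary.AllPairs using ([]; _∷_)
open import Data.List.Relation.Unary.Any using (here; there)
open import Data.List.Relation.Unary.Unique.Propositional using (Unique)
import Data.List.Relation.Unary.Unique.Propositional.Properties as Unique
open import Data.Maybe using (Maybe; just; nothing)
open import Data.Nat as ℕ using (ℕ; zero; suc; NonZero; _≤_; _<_; _⊔_; z≤n; s≤s)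
open import Data.Nat.Coprimality using (Coprime; coprime-Bézout; prime⇒coprime)
import Data.Nat.Coprimality as Coprimality
open import Data.Nat.DivMod using (_%_; _/_; _mod_; m<n⇒m%n≡m; %-distribˡ-+; %-distribˡ-*; n%n≡0; m%n<n; m*n%n≡0; m≡m%n+[m/n]*n)
open import Data.Nat.GCD using (module Bézout)
open import Data.Nat.ListAction using (product)
open import Data.Nat.ListAction.Properties using (∈⇒∣product)
open import Data.Nat.Primality using (Prime; prime⇒nonTrivial; prime⇒nonZero)
open import Data.Nat.Primality.Factorisation using (PrimeFactorisation; factorise)
import Data.Nat.Properties as ℕ
open import Data.Nat.Tactic.RingSolver using (solve-∀)
open import Data.Product using (_×_; _,_; ∃; proj₁; proj₂)
open import Data.Sum as Sum using (_⊎_; inj₁; inj₂)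
open import Data.Vec using ([]; _∷_; lookup)
open import Data.Vec.Properties using (lookup⇒[]=; lookup∘tabulate)
open import Algebra.Properties.Semiring.Sum ℕ.+-*-semiring
  using (sum; ∑-distrib-+; sum-permute; *-distribˡ-sum; sum-replicate-zero; sum-cong-≗)
open import Function using (_∘_; case_of_)
open import Level using (0ℓ)
open import Relation.Binary.Definitions using (tri<; tri≈; tri>)
open import Relation.Binary.PropositionalEquality hiding (setoid; [_])
open import Relation.Nullary using (Dec; yes; no; ¬_; ¬?; contradiction; does)
open import Relation.Nullary.Decidable using (⌊_⌋; _×-dec_; dec-true; isYes≗does)

-- Fibres of S may be empty even though S is not, so the induction must include S = ∅, where the
-- bound is the Cauchy-Davenport one, |A| + |B| - 1. This is why 3|S| becomes max(1, 3|S|). An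
-- arbitrary covering C is used because covering passes to fibres: the fibre of C over i + j covers
-- the sums of the fibres of A over i and of B over j, whichever other pairs of classes share it.
-- The constant 3 splits as 2 + 1. The theorem in ℤ/q loses 1 + 2|S|, where 2 is charged per
-- exceptional class, and comparing a fibre of B with one of C and one of S charges every element of
-- S once more. The leftover 1 is absorbed whenever S is non-empty. The threshold σ ≥ α is
-- affordable only for α ≥ 2. For α = 1 a class with σ = 1 could cost more than 3, so the case where
-- all fibres of A have at most one element gets its own count, which distinguishes whether some
-- fibre of S is large enough to hide a whole fibre of B. The polynomial method needs 2 ≠ 0, which
-- forces odd primes; the case p = 2 is settled by elementary counting.

Unique-⊆⇒length≤ : ∀ {X : Set} {xs ys : List X} → Unique xs →
  (∀ {x} → x ∈ xs → x ∈ ys) → length xs ℕ.≤ length ys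
Unique-⊆⇒length≤ {xs = []} [] _ = ℕ.z≤n
Unique-⊆⇒length≤ {xs = x ∷ xs} (x∉xs ∷ uniq) xs⊆ys with ∈-∃++ (xs⊆ys (here refl))
... | us , vs , refl = begin
  suc (length xs)                    ≤⟨ ℕ.s≤s (Unique-⊆⇒length≤ uniq xs⊆us++vs) ⟩
  suc (length (us ++ vs))            ≡⟨ cong suc (length-++ us) ⟩
  suc (length us ℕ.+ length vs)      ≡⟨ ℕ.+-suc (length us) (length vs) ⟨
  length us ℕ.+ length (x ∷ vs)      ≡⟨ length-++ us ⟨
  length (us ++ x ∷ vs)              ∎
  where
  open ℕ.≤-Reasoning
  xs⊆us++vs : ∀ {z} → z ∈ xs → z ∈ us ++ vs
  xs⊆us++vs z∈xs with ∈-++⁻ us (xs⊆ys (there z∈xs))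
  ... | inj₁ z∈us         = ∈-++⁺ˡ z∈us
  ... | inj₂ (here refl)  = contradiction refl (All.lookup x∉xs z∈xs)
  ... | inj₂ (there z∈vs) = ∈-++⁺ʳ us z∈vs

length-≤-images : ∀ {X Y Z : Set} {xs : List X} {ys : List Y} {zs : List Z} (g : Y → X) (h : Z → X) → Unique xs →
  (∀ {x} → x ∈ xs → ∃ (λ y → y ∈ ys × x ≡ g y) ⊎ ∃ (λ z → z ∈ zs × x ≡ h z)) →
  length xs ℕ.≤ length ys ℕ.+ length zs
length-≤-images {xs = xs} {ys} {zs} g h uniq image = begin
  length xs                               ≤⟨ Unique-⊆⇒length≤ uniq (λ x∈ → mapped (image x∈)) ⟩
  length (map g ys ++ map h zs)           ≡⟨ length-++ (map g ys) ⟩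
  length (map g ys) ℕ.+ length (map h zs) ≡⟨ cong₂ ℕ._+_ (length-map g ys) (length-map h zs) ⟩
  length ys ℕ.+ length zs                 ∎
  where
  open ℕ.≤-Reasoning
  mapped : ∀ {x} → ∃ (λ y → y ∈ ys × x ≡ g y) ⊎ ∃ (λ z → z ∈ zs × x ≡ h z) → x ∈ map g ys ++ map h zs
  mapped (inj₁ (_ , y∈ , refl)) = ∈-++⁺ˡ (∈-map⁺ g y∈)
  mapped (inj₂ (_ , z∈ , refl)) = ∈-++⁺ʳ (map g ys) (∈-map⁺ h z∈)

-- A ring solver whose coefficients are formal differences of natural numbers,
-- so that cancellations such as x - x ≈ 0 are decided in an abstract ring.
module DifferenceSolver (R : CommutativeRing 0ℓ 0ℓ) where
  open CommutativeRing R hiding (zero) renaming (refl to ≈-refl; sym to ≈-sym; trans to ≈-trans)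
  open import Algebra.Properties.Semiring.Mult semiring renaming (_×_ to _·_)
  open import Algebra.Properties.Ring ring
  open import Algebra.Properties.CommutativeSemigroup +-commutativeSemigroup using (interchange)
  open import Relation.Binary.Reasoning.Setoid setoid

  ⟦_⟧ : ℕ × ℕ → Carrier
  ⟦ 0 , 0 ⟧ = 0#
  ⟦ 1 , 0 ⟧ = 1#
  ⟦ a , b ⟧ = a · 1# - b · 1#

  ⟦⟧-difference : ∀ x → ⟦ x ⟧ ≈ proj₁ x · 1# - proj₂ x · 1#
  ⟦⟧-difference (0 , 0)             = ≈-sym (-‿inverseʳ 0#)
  ⟦⟧-difference (0 , suc b)         = ≈-refl
  ⟦⟧-difference (1 , 0)             = ≈-sym (≈-trans (+-congˡ -0#≈0#) (≈-trans (+-identityʳ _) (+-identityʳ _)))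
  ⟦⟧-difference (1 , suc b)         = ≈-refl
  ⟦⟧-difference (suc (suc a) , b)   = ≈-refl

  differences : RawRing 0ℓ 0ℓ
  differences = record
    { Carrier = ℕ × ℕ
    ; _≈_ = _≡_
    ; _+_ = λ (a , b) (c , d) → a ℕ.+ c , b ℕ.+ d
    ; _*_ = λ (a , b) (c , d) → a ℕ.* c ℕ.+ b ℕ.* d , a ℕ.* d ℕ.+ b ℕ.* c
    ; -_ = λ (a , b) → b , a
    ; 0# = 0 , 0
    ; 1# = 1 , 0
    }

  -‿interchange : ∀ a b c d → (a + c) - (b + d) ≈ (a - b) + (c - d)
  -‿interchange a b c d = begin
    (a + c) - (b + d)       ≈⟨ +-congˡ (-‿+-comm b d) ⟨
    (a + c) + (- b - d)     ≈⟨ interchange a c (- b) (- d) ⟩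
    (a - b) + (c - d)       ∎

  *-difference : ∀ a b c d → (a * c + b * d) - (a * d + b * c) ≈ (a - b) * (c - d)
  *-difference a b c d = begin
    (a * c + b * d) - (a * d + b * c)  ≈⟨ -‿interchange (a * c) (a * d) (b * d) (b * c) ⟩
    (a * c - a * d) + (b * d - b * c)  ≈⟨ +-cong (x[y-z]≈xy-xz a c d) (x[y-z]≈xy-xz b d c) ⟨
    a * (c - d) + b * (d - c)          ≈⟨ +-congˡ (*-congˡ (⁻¹-anti-homo‿- c d)) ⟨
    a * (c - d) + b * - (c - d)        ≈⟨ +-congˡ (-‿distribʳ-* b (c - d)) ⟨
    a * (c - d) - b * (c - d)          ≈⟨ [y-z]x≈yx-zx (c - d) a b ⟨
    (a - b) * (c - d)                  ∎

  morphism : differences ACR.-Raw-AlmostCommutative⟶ ACR.fromCommutativeRing R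
  morphism = record
    { ⟦_⟧ = ⟦_⟧
    ; +-homo = λ x@(a , b) y@(c , d) → ≈-trans (⟦⟧-difference (a ℕ.+ c , b ℕ.+ d)) (≈-trans
        (≈-trans (+-cong (×-homo-+ 1# a c) (-‿cong (×-homo-+ 1# b d))) (-‿interchange _ _ _ _))
        (≈-sym (+-cong (⟦⟧-difference x) (⟦⟧-difference y))))
    ; *-homo = λ x@(a , b) y@(c , d) → ≈-trans (⟦⟧-difference (a ℕ.* c ℕ.+ b ℕ.* d , a ℕ.* d ℕ.+ b ℕ.* c)) (≈-trans
        (≈-trans
          (+-cong (≈-trans (×-homo-+ 1# (a ℕ.* c) (b ℕ.* d)) (+-cong (×1-homo-* a c) (×1-homo-* b d)))
            (-‿cong (≈-trans (×-homo-+ 1# (a ℕ.* d) (b ℕ.* c)) (+-cong (×1-homo-* a d) (×1-homo-* b c)))))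
          (*-difference _ _ _ _))
        (≈-sym (*-cong (⟦⟧-difference x) (⟦⟧-difference y))))
    ; -‿homo = λ x@(a , b) → ≈-trans (⟦⟧-difference (b , a)) (≈-trans
        (≈-sym (⁻¹-anti-homo‿- _ _)) (≈-sym (-‿cong (⟦⟧-difference x))))
    ; 0-homo = ≈-refl
    ; 1-homo = ≈-refl
    }

  difference? : ∀ x y → Maybe (⟦ x ⟧ ≈ ⟦ y ⟧)
  difference? x@(a , b) y@(c , d) with a ℕ.+ d ℕ.≟ c ℕ.+ b
  ... | no _ = nothing
  ... | yes eq = just (begin
    ⟦ x ⟧                                          ≈⟨ ⟦⟧-difference x ⟩
    a · 1# - b · 1#                                ≈⟨ +-identityʳ _ ⟨
    (a · 1# - b · 1#) + 0#                         ≈⟨ +-congˡ (-‿inverseʳ (d · 1#)) ⟨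
    (a · 1# - b · 1#) + (d · 1# - d · 1#)          ≈⟨ -‿interchange _ _ _ _ ⟨
    (a · 1# + d · 1#) - (b · 1# + d · 1#)          ≈⟨ +-congʳ (×-homo-+ 1# a d) ⟨
    (a ℕ.+ d) · 1# - (b · 1# + d · 1#)             ≡⟨ cong (λ n → n · 1# - (b · 1# + d · 1#)) eq ⟩
    (c ℕ.+ b) · 1# - (b · 1# + d · 1#)             ≈⟨ +-cong (×-homo-+ 1# c b) (-‿cong (+-comm _ _)) ⟩
    (c · 1# + b · 1#) - (d · 1# + b · 1#)          ≈⟨ -‿interchange _ _ _ _ ⟩
    (c · 1# - d · 1#) + (b · 1# - b · 1#)          ≈⟨ +-congˡ (-‿inverseʳ (b · 1#)) ⟩
    (c · 1# - d · 1#) + 0#                         ≈⟨ +-identityʳ _ ⟩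
    c · 1# - d · 1#                                ≈⟨ ⟦⟧-difference y ⟨
    ⟦ y ⟧                                          ∎)

  open Algebra.Solver.Ring differences (ACR.fromCommutativeRing R) morphism difference? public
    using (solve; con; _:+_; _:*_; _:-_; :-_; _:=_)

-- Coefficients of products of linear forms from values on a grid

module PolynomialMethod
  {F : Set} {_+′_ _*′_ : Op₂ F} { -′_ : Op₁ F} {0′ 1′ : F}
  (isCommutativeRing : IsCommutativeRing _≡_ _+′_ _*′_ -′_ 0′ 1′)
  (inv : F → F) (inv-inverse : ∀ x → x ≢ 0′ → inv x *′ x ≡ 1′)
  where

  R : CommutativeRing 0ℓ 0ℓ
  R = record { isCommutativeRing = isCommutativeRing }

  open CommutativeRing R using (_+_; _*_; -_; _-_; 0#; 1#)
  open CommutativeRing R using (zeroˡ; zeroʳ; +-identityˡ; *-assoc; *-comm; *-identityˡ; *-identityʳ; -‿inverseʳ)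
  open import Algebra.Properties.Group (CommutativeRing.+-group R) using (x∙y⁻¹≈ε⇒x≈y)
  open DifferenceSolver R
  open ≡-Reasoning

  x≢y⇒x-y≢0 : ∀ {x y} → x ≢ y → x - y ≢ 0#
  x≢y⇒x-y≢0 x≢y eq = x≢y (x∙y⁻¹≈ε⇒x≈y _ _ eq)

  *-nonzero : ∀ {x y} → x ≢ 0# → y ≢ 0# → x * y ≢ 0#
  *-nonzero {x} {y} x≢0 y≢0 xy≡0 = y≢0 (begin
    y                  ≡⟨ *-identityˡ y ⟨
    1# * y             ≡⟨ cong (_* y) (inv-inverse x x≢0) ⟨
    (inv x * x) * y    ≡⟨ *-assoc _ _ _ ⟩
    inv x * (x * y)    ≡⟨ cong (inv x *_) xy≡0 ⟩
    inv x * 0#         ≡⟨ zeroʳ _ ⟩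
    0#                 ∎)

  -- Divided differences

  dd : (F → F) → F → List F → F
  dd f x []       = f x
  dd f x (y ∷ ys) = inv (x - y) * (dd f x ys - dd f y ys)

  dd-cong : ∀ {f g} x ys → (∀ z → f z ≡ g z) → dd f x ys ≡ dd g x ys
  dd-cong x []       eq = eq x
  dd-cong x (y ∷ ys) eq = cong₂ (λ u v → inv (x - y) * (u - v)) (dd-cong x ys eq) (dd-cong y ys eq)

  dd-linear : ∀ f g k x ys → dd (λ z → f z + k * g z) x ys ≡ dd f x ys + k * dd g x ys
  dd-linear f g k x []       = refl
  dd-linear f g k x (y ∷ ys) = begin
    inv (x - y) * (dd (λ z → f z + k * g z) x ys - dd (λ z → f z + k * g z) y ys)
      ≡⟨ cong₂ (λ u v → inv (x - y) * (u - v)) (dd-linear f g k x ys) (dd-linear f g k y ys) ⟩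
    inv (x - y) * ((dd f x ys + k * dd g x ys) - (dd f y ys + k * dd g y ys))
      ≡⟨ solve 6 (λ i k a b c d → i :* ((a :+ k :* b) :- (c :+ k :* d)) := i :* (a :- c) :+ k :* (i :* (b :- d)))
           refl (inv (x - y)) k (dd f x ys) (dd g x ys) (dd f y ys) (dd g y ys) ⟩
    inv (x - y) * (dd f x ys - dd f y ys) + k * (inv (x - y) * (dd g x ys - dd g y ys)) ∎

  dd-vanish : ∀ f x ys → (∀ {z} → z ∈ x ∷ ys → f z ≡ 0#) → dd f x ys ≡ 0#
  dd-vanish f x []       f≡0 = f≡0 (here refl)
  dd-vanish f x (y ∷ ys) f≡0 = begin
    inv (x - y) * (dd f x ys - dd f y ys)
      ≡⟨ cong₂ (λ u v → inv (x - y) * (u - v))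
           (dd-vanish f x ys λ { (here eq) → f≡0 (here eq) ; (there z∈) → f≡0 (there (there z∈)) })
           (dd-vanish f y ys λ z∈ → f≡0 (there z∈)) ⟩
    inv (x - y) * (0# - 0#)  ≡⟨ cong (inv (x - y) *_) (-‿inverseʳ 0#) ⟩
    inv (x - y) * 0#         ≡⟨ zeroʳ _ ⟩
    0#                       ∎

  dd-scale : ∀ f k x ys → dd (λ z → k * f z) x ys ≡ k * dd f x ys
  dd-scale f k x ys = begin
    dd (λ z → k * f z) x ys              ≡⟨ dd-cong x ys (λ z → +-identityˡ (k * f z)) ⟨
    dd (λ z → 0# + k * f z) x ys         ≡⟨ dd-linear (λ _ → 0#) f k x ys ⟩
    dd (λ _ → 0#) x ys + k * dd f x ys   ≡⟨ cong (_+ k * dd f x ys) (dd-vanish _ x ys λ _ → refl) ⟩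
    0# + k * dd f x ys                   ≡⟨ +-identityˡ _ ⟩
    k * dd f x ys                        ∎

  dd-const : ∀ k x y ys → dd (λ _ → k) x (y ∷ ys) ≡ 0#
  dd-const k x y ys = begin
    inv (x - y) * (dd (λ _ → k) x ys - dd (λ _ → k) y ys)
      ≡⟨ cong (λ u → inv (x - y) * (u - dd (λ _ → k) y ys)) (independent ys) ⟩
    inv (x - y) * (dd (λ _ → k) y ys - dd (λ _ → k) y ys)
      ≡⟨ cong (inv (x - y) *_) (-‿inverseʳ _) ⟩
    inv (x - y) * 0#  ≡⟨ zeroʳ _ ⟩
    0#                ∎
    where
    independent : ∀ ys → dd (λ _ → k) x ys ≡ dd (λ _ → k) y ys
    independent []       = refl
    independent (z ∷ zs) = trans (dd-const k x z zs) (sym (dd-const k y z zs))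

  dd-root : ∀ (f : F → F) x → dd (λ z → (z - x) * f z) x [] ≡ 0#
  dd-root f x = trans (cong (_* f x) (-‿inverseʳ x)) (zeroˡ (f x))

  -- Leibniz rule for divided differences with a factor vanishing at the first node: a factor z - x
  -- is traded for the node x. Distinctness of the nodes enters here, to cancel x - y.
  dd-shift : ∀ f x y ys → Unique (x ∷ y ∷ ys) → dd (λ z → (z - x) * f z) x (y ∷ ys) ≡ dd f y ys
  dd-shift f x y ys ((x≢y ∷ x∉ys) ∷ y∉ys ∷ uniq) = begin
    i * (dd g x ys - dd g y ys)              ≡⟨ cong (i *_) (difference ys x∉ys y∉ys uniq) ⟩
    i * ((x - y) * dd f y ys)                ≡⟨ *-assoc _ _ _ ⟨
    (i * (x - y)) * dd f y ys                ≡⟨ cong (_* dd f y ys) (inv-inverse _ (x≢y⇒x-y≢0 x≢y)) ⟩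
    1# * dd f y ys                           ≡⟨ *-identityˡ _ ⟩
    dd f y ys                                ∎
    where
    i = inv (x - y)
    g : F → F
    g z = (z - x) * f z
    recentre : ∀ ys → dd g y ys ≡ dd (λ z → (z - y) * f z) y ys + (y - x) * dd f y ys
    recentre ys = trans
      (dd-cong y ys λ z → solve 4 (λ x y z w → (z :- x) :* w := (z :- y) :* w :+ (y :- x) :* w) refl x y z (f z))
      (dd-linear (λ z → (z - y) * f z) f (y - x) y ys)
    difference : ∀ ys → All (x ≢_) ys → All (y ≢_) ys → Unique ys →
      dd g x ys - dd g y ys ≡ (x - y) * dd f y ys
    difference [] _ _ _ = solve 4 (λ x y w w′ →
      (x :- x) :* w′ :- (y :- x) :* w := (x :- y) :* w) refl x y (f y) (f x)
    difference (z ∷ zs) x∉ y∉ u = begin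
      dd g x (z ∷ zs) - dd g y (z ∷ zs)
        ≡⟨ cong₂ _-_ (dd-shift f x z zs (x∉ ∷ u)) (trans (recentre (z ∷ zs))
             (cong (_+ (y - x) * dd f y (z ∷ zs)) (dd-shift f y z zs (y∉ ∷ u)))) ⟩
      dd f z zs - (dd f z zs + (y - x) * dd f y (z ∷ zs))
        ≡⟨ solve 4 (λ x y a b → a :- (a :+ (y :- x) :* b) := (x :- y) :* b) refl x y _ _ ⟩
      (x - y) * dd f y (z ∷ zs) ∎

  -- Divided difference in both variables. It depends only on the values of P on the grid, yet on
  -- polynomials of total degree at most |xs| + |ys| it reads off the coefficient of u^|xs| v^|ys|.
  -- This is the coefficient formula behind the Combinatorial Nullstellensatz.
  Φ : (F → F → F) → F → List F → F → List F → F
  Φ P x xs y ys = dd (λ u → dd (P u) y ys) x xs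

  Φ-linear : ∀ (P Q : F → F → F) k x xs y ys →
    Φ (λ u v → P u v + k * Q u v) x xs y ys ≡ Φ P x xs y ys + k * Φ Q x xs y ys
  Φ-linear P Q k x xs y ys = trans
    (dd-cong x xs λ u → dd-linear (P u) (Q u) k y ys)
    (dd-linear _ _ k x xs)

  Φ-vanish : ∀ P x xs y ys → (∀ {u v} → u ∈ x ∷ xs → v ∈ y ∷ ys → P u v ≡ 0#) → Φ P x xs y ys ≡ 0#
  Φ-vanish P x xs y ys P≡0 = dd-vanish _ x xs λ u∈ → dd-vanish _ y ys λ v∈ → P≡0 u∈ v∈

  Φ-shiftˡ : ∀ (P : F → F → F) x x′ xs y ys → Unique (x ∷ x′ ∷ xs) →
    Φ (λ u v → (u - x) * P u v) x (x′ ∷ xs) y ys ≡ Φ P x′ xs y ys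
  Φ-shiftˡ P x x′ xs y ys uniq = trans
    (dd-cong x (x′ ∷ xs) λ u → dd-scale (P u) (u - x) y ys)
    (dd-shift _ x x′ xs uniq)

  Φ-rootˡ : ∀ (P : F → F → F) x y ys → Φ (λ u v → (u - x) * P u v) x [] y ys ≡ 0#
  Φ-rootˡ P x y ys = trans (dd-scale (P x) (x - x) y ys) (dd-root (λ u → dd (P u) y ys) x)

  Φ-shiftʳ : ∀ (P : F → F → F) x xs y y′ ys → Unique (y ∷ y′ ∷ ys) →
    Φ (λ u v → (v - y) * P u v) x xs y (y′ ∷ ys) ≡ Φ P x xs y′ ys
  Φ-shiftʳ P x xs y y′ ys uniq = dd-cong x xs λ u → dd-shift (P u) y y′ ys uniq

  Φ-rootʳ : ∀ (P : F → F → F) x xs y → Φ (λ u v → (v - y) * P u v) x xs y [] ≡ 0#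
  Φ-rootʳ P x xs y = dd-vanish _ x xs λ {u} _ → dd-root (P u) y

  -- The pair (ε , r) stands for the linear form u + ε v - r.

  form : F × F → F → F → F
  form (ε , r) u v = (u + ε * v) - r

  forms : List (F × F) → F → F → F
  forms []       u v = 1#
  forms (l ∷ ls) u v = form l u v * forms ls u v

  -- Rests on form (u, v) = (u - x) + ε (v - y) + form (x, y). The first two summands remove a node
  -- by the shift lemmas, so products of forms are handled by recursion without ever being expanded.
  Φ-forms-step : ∀ ε r ls x xs y ys → Φ (forms ((ε , r) ∷ ls)) x xs y ys ≡
    (Φ (λ u v → (u - x) * forms ls u v) x xs y ys + ε * Φ (λ u v → (v - y) * forms ls u v) x xs y ys)
      + form (ε , r) x y * Φ (forms ls) x xs y ys
  Φ-forms-step ε r ls x xs y ys = begin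
    Φ (forms ((ε , r) ∷ ls)) x xs y ys
      ≡⟨ dd-cong x xs (λ u → dd-cong y ys λ v →
           solve 7 (λ ε r x y u v P → ((u :+ ε :* v) :- r) :* P :=
             ((u :- x) :* P :+ ε :* ((v :- y) :* P)) :+ ((x :+ ε :* y) :- r) :* P)
             refl ε r x y u v (forms ls u v)) ⟩
    Φ (λ u v → ((u - x) * P u v + ε * ((v - y) * P u v)) + form (ε , r) x y * P u v) x xs y ys
      ≡⟨ Φ-linear _ P _ x xs y ys ⟩
    Φ (λ u v → (u - x) * P u v + ε * ((v - y) * P u v)) x xs y ys + form (ε , r) x y * Φ P x xs y ys
      ≡⟨ cong (_+ form (ε , r) x y * Φ P x xs y ys) (Φ-linear _ _ ε x xs y ys) ⟩
    _ ∎
    where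
    P : F → F → F
    P = forms ls

  -- Every summand of `Φ-forms-step` has one form fewer and loses at most one node, so the deficit
  -- in degree persists until a constant meets a divided difference of positive order.
  Φ-forms-low : ∀ ls x xs y ys → Unique (x ∷ xs) → Unique (y ∷ ys) →
    length ls ℕ.< length xs ℕ.+ length ys → Φ (forms ls) x xs y ys ≡ 0#
  Φ-forms-low [] x (x′ ∷ xs) y []        _ _ _ = dd-const 1# x x′ xs
  Φ-forms-low [] x xs        y (y′ ∷ ys) _ _ _ = dd-vanish _ x xs λ _ → dd-const 1# y y′ ys
  Φ-forms-low ((ε , r) ∷ ls) x xs y ys ux uy lt = begin
    Φ (forms ((ε , r) ∷ ls)) x xs y ys  ≡⟨ Φ-forms-step ε r ls x xs y ys ⟩
    _                                   ≡⟨ cong₂ _+_ (cong₂ (λ a b → a + ε * b) (left xs ux lt) (right ys uy lt))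
                                             (cong (form (ε , r) x y *_)
                                                (Φ-forms-low ls x xs y ys ux uy (ℕ.<-trans (ℕ.n<1+n _) lt))) ⟩
    (0# + ε * 0#) + form (ε , r) x y * 0#
      ≡⟨ solve 2 (λ ε k → (con (0 , 0) :+ ε :* con (0 , 0)) :+ k :* con (0 , 0) := con (0 , 0)) refl ε _ ⟩
    0#                                  ∎
    where
    left : ∀ xs → Unique (x ∷ xs) → suc (length ls) ℕ.< length xs ℕ.+ length ys →
      Φ (λ u v → (u - x) * forms ls u v) x xs y ys ≡ 0#
    left []        _  _  = Φ-rootˡ (forms ls) x y ys
    left (x′ ∷ xs) u@(_ ∷ u′) lt = trans (Φ-shiftˡ (forms ls) x x′ xs y ys u)
      (Φ-forms-low ls x′ xs y ys u′ uy (ℕ.s<s⁻¹ lt))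
    right : ∀ ys → Unique (y ∷ ys) → suc (length ls) ℕ.< length xs ℕ.+ length ys →
      Φ (λ u v → (v - y) * forms ls u v) x xs y ys ≡ 0#
    right []        _  _  = Φ-rootʳ (forms ls) x xs y
    right (y′ ∷ ys) u@(_ ∷ u′) lt = trans (Φ-shiftʳ (forms ls) x xs y y′ ys u)
      (Φ-forms-low ls x xs y′ ys ux u′ (ℕ.s<s⁻¹ (subst (suc (length ls) ℕ.<_) (ℕ.+-suc _ _) lt)))

  -- Coefficient lists of univariate polynomials, with the constant coefficient first

  nth : List F → ℕ → F
  nth []       _       = 0#
  nth (c ∷ cs) zero    = c
  nth (c ∷ cs) (suc m) = nth cs m

  -- The coefficients of p + (z + ε) Σ cᵢ zⁱ.
  multiply : F → F → List F → List F
  multiply ε p []       = p ∷ []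
  multiply ε p (c ∷ cs) = (p + ε * c) ∷ multiply ε c cs

  -- The part of highest degree of forms ls at u = z, v = 1.
  leading : List (F × F) → List F
  leading []             = 1# ∷ []
  leading ((ε , _) ∷ ls) = multiply ε 0# (leading ls)

  nth-multiply : ∀ ε p cs m → nth (multiply ε p cs) m ≡ nth (p ∷ cs) m + ε * nth cs m
  nth-multiply ε p []       zero    = solve 2 (λ ε p → p := p :+ ε :* con (0 , 0)) refl ε p
  nth-multiply ε p []       (suc m) = solve 1 (λ ε → con (0 , 0) := con (0 , 0) :+ ε :* con (0 , 0)) refl ε
  nth-multiply ε p (c ∷ cs) zero    = refl
  nth-multiply ε p (c ∷ cs) (suc m) = nth-multiply ε c cs m

  length-multiply : ∀ ε p cs → length (multiply ε p cs) ≡ suc (length cs)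
  length-multiply ε p []       = refl
  length-multiply ε p (c ∷ cs) = cong suc (length-multiply ε c cs)

  length-leading : ∀ ls → length (leading ls) ≡ suc (length ls)
  length-leading []             = refl
  length-leading ((ε , _) ∷ ls) = trans (length-multiply ε 0# (leading ls)) (cong suc (length-leading ls))

  nth-beyond : ∀ cs m → length cs ℕ.≤ m → nth cs m ≡ 0#
  nth-beyond []       m       _  = refl
  nth-beyond (c ∷ cs) (suc m) le = nth-beyond cs m (ℕ.s≤s⁻¹ le)

  -- At the critical degree the third summand of `Φ-forms-step` vanishes by `Φ-forms-low`, and the
  -- other two reproduce the recursion for the coefficients of a product with z + ε.
  Φ-forms-leading : ∀ ls x xs y ys → Unique (x ∷ xs) → Unique (y ∷ ys) →
    length ls ≡ length xs ℕ.+ length ys → Φ (forms ls) x xs y ys ≡ nth (leading ls) (length xs)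
  Φ-forms-leading [] x [] y [] _ _ _ = refl
  Φ-forms-leading ((ε , r) ∷ ls) x xs y ys ux uy eq = begin
    Φ (forms ((ε , r) ∷ ls)) x xs y ys  ≡⟨ Φ-forms-step ε r ls x xs y ys ⟩
    _                                   ≡⟨ cong₂ _+_ (cong₂ (λ a b → a + ε * b) (left xs ux eq) (right ys uy eq))
                                             (cong (form (ε , r) x y *_)
                                                (Φ-forms-low ls x xs y ys ux uy (ℕ.≤-reflexive eq))) ⟩
    (nth (0# ∷ leading ls) (length xs) + ε * nth (leading ls) (length xs)) + form (ε , r) x y * 0#
      ≡⟨ solve 2 (λ a k → a :+ k :* con (0 , 0) := a) refl _ _ ⟩
    nth (0# ∷ leading ls) (length xs) + ε * nth (leading ls) (length xs)
      ≡⟨ nth-multiply ε 0# (leading ls) (length xs) ⟨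
    nth (multiply ε 0# (leading ls)) (length xs) ∎
    where
    left : ∀ xs → Unique (x ∷ xs) → suc (length ls) ≡ length xs ℕ.+ length ys →
      Φ (λ u v → (u - x) * forms ls u v) x xs y ys ≡ nth (0# ∷ leading ls) (length xs)
    left []        _  _  = Φ-rootˡ (forms ls) x y ys
    left (x′ ∷ xs) u@(_ ∷ u′) eq = trans (Φ-shiftˡ (forms ls) x x′ xs y ys u)
      (Φ-forms-leading ls x′ xs y ys u′ uy (ℕ.suc-injective eq))
    right : ∀ ys → Unique (y ∷ ys) → suc (length ls) ≡ length xs ℕ.+ length ys →
      Φ (λ u v → (v - y) * forms ls u v) x xs y ys ≡ nth (leading ls) (length xs)
    -- With no node left in v, |xs| exceeds the degree of `leading ls`, so the coefficient asked for
    -- is zero too.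
    right []        _  eq = trans (Φ-rootʳ (forms ls) x xs y)
      (sym (nth-beyond (leading ls) (length xs)
        (ℕ.≤-reflexive (trans (length-leading ls) (trans eq (ℕ.+-identityʳ _))))))
    right (y′ ∷ ys) u@(_ ∷ u′) eq = trans (Φ-shiftʳ (forms ls) x xs y y′ ys u)
      (Φ-forms-leading ls x xs y′ ys ux u′ (ℕ.suc-injective (trans eq (ℕ.+-suc _ _))))

  -- Pairing coefficients with a weight

  ⟨_,_⟩ : List F → (ℕ → F) → F
  ⟨ [] , w ⟩     = 0#
  ⟨ c ∷ cs , w ⟩ = c * w 0 + ⟨ cs , (λ m → w (suc m)) ⟩

  pairing-vanish : ∀ cs w → (∀ m → nth cs m ≡ 0# ⊎ w m ≡ 0#) → ⟨ cs , w ⟩ ≡ 0#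
  pairing-vanish []       w h = refl
  pairing-vanish (c ∷ cs) w h = begin
    c * w 0 + ⟨ cs , (λ m → w (suc m)) ⟩ ≡⟨ cong₂ _+_ (head (h 0)) (pairing-vanish cs _ λ m → h (suc m)) ⟩
    0# + 0#                              ≡⟨ +-identityˡ 0# ⟩
    0#                                   ∎
    where
    head : c ≡ 0# ⊎ w 0 ≡ 0# → c * w 0 ≡ 0#
    head (inj₁ eq) = trans (cong (_* w 0) eq) (zeroˡ _)
    head (inj₂ eq) = trans (cong (c *_) eq) (zeroʳ _)

  -- Multiplication by z + ε is adjoint to w(m) ↦ w(m+1) + ε w(m). Linear factors can therefore be
  -- moved to the weight one by one, and a factor z - 1 becomes the finite difference Δ.
  pairing-multiply : ∀ ε p cs w →
    ⟨ multiply ε p cs , w ⟩ ≡ p * w 0 + ⟨ cs , (λ m → w (suc m) + ε * w m) ⟩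
  pairing-multiply ε p []       w = refl
  pairing-multiply ε p (c ∷ cs) w = begin
    (p + ε * c) * w 0 + ⟨ multiply ε c cs , (λ m → w (suc m)) ⟩
      ≡⟨ cong ((p + ε * c) * w 0 +_) (pairing-multiply ε c cs _) ⟩
    (p + ε * c) * w 0 + (c * w 1 + ⟨ cs , (λ m → w (suc (suc m)) + ε * w (suc m)) ⟩)
      ≡⟨ solve 6 (λ ε p c w₀ w₁ t → (p :+ ε :* c) :* w₀ :+ (c :* w₁ :+ t) :=
           p :* w₀ :+ (c :* (w₁ :+ ε :* w₀) :+ t)) refl ε p c (w 0) (w 1) _ ⟩
    p * w 0 + (c * (w 1 + ε * w 0) + ⟨ cs , (λ m → w (suc (suc m)) + ε * w (suc m)) ⟩) ∎

  pairing-leading : ∀ ε r ls w →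
    ⟨ leading ((ε , r) ∷ ls) , w ⟩ ≡ ⟨ leading ls , (λ m → w (suc m) + ε * w m) ⟩
  pairing-leading ε r ls w = trans (pairing-multiply ε 0# (leading ls) w)
    (solve 2 (λ a b → con (0 , 0) :* a :+ b := b) refl _ _)

  pairing-cong : ∀ cs {w w′} → (∀ m → w m ≡ w′ m) → ⟨ cs , w ⟩ ≡ ⟨ cs , w′ ⟩
  pairing-cong []       eq = refl
  pairing-cong (c ∷ cs) eq = cong₂ _+_ (cong (c *_) (eq 0)) (pairing-cong cs λ m → eq (suc m))

  -- Finite differences

  Δ : (ℕ → F) → ℕ → F
  Δ w m = w (suc m) + (- 1#) * w m

  Δ^ : ℕ → (ℕ → F) → ℕ → F
  Δ^ zero    w = w
  Δ^ (suc r) w = Δ (Δ^ r w)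

  Δ^-Δ : ∀ r w m → Δ^ r (Δ w) m ≡ Δ (Δ^ r w) m
  Δ^-Δ zero    w m = refl
  Δ^-Δ (suc r) w m = cong₂ (λ a b → a + (- 1#) * b) (Δ^-Δ r w (suc m)) (Δ^-Δ r w m)

  ι : ℕ → F
  ι zero    = 0#
  ι (suc n) = 1# + ι n

  -- Discrete Leibniz rule: the factor ι m - e has first difference 1 and higher differences 0, so
  -- only two terms survive.
  Δ^-Leibniz : ∀ r e w m → Δ^ (suc r) (λ m → (ι m - e) * w m) m ≡
    (ι m - e) * Δ^ (suc r) w m + ι (suc r) * Δ^ r w (suc m)
  Δ^-Leibniz zero e w m = solve 4 (λ i e a b →
    ((con (1 , 0) :+ i) :- e) :* a :+ (:- con (1 , 0)) :* ((i :- e) :* b) :=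
    (i :- e) :* (a :+ (:- con (1 , 0)) :* b) :+ (con (1 , 0) :+ con (0 , 0)) :* a)
    refl (ι m) e (w (suc m)) (w m)
  Δ^-Leibniz (suc r) e w m = trans
    (cong₂ (λ a b → a + (- 1#) * b) (Δ^-Leibniz r e w (suc m)) (Δ^-Leibniz r e w m))
    (solve 6 (λ i e j a b c →
      (((con (1 , 0) :+ i) :- e) :* (a :+ (:- con (1 , 0)) :* b) :+ (con (1 , 0) :+ j) :* a)
        :+ (:- con (1 , 0)) :* ((i :- e) :* c :+ (con (1 , 0) :+ j) :* b) :=
      (i :- e) :* ((a :+ (:- con (1 , 0)) :* b) :+ (:- con (1 , 0)) :* c)
        :+ (con (1 , 0) :+ (con (1 , 0) :+ j)) :* (a :+ (:- con (1 , 0)) :* b))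
      refl (ι m) e (ι r) (Δ^ r w (suc (suc m))) (Δ^ r w (suc m)) (Δ^ (suc r) w m))

  vanishingAt : List ℕ → ℕ → F
  vanishingAt []       m = 1#
  vanishingAt (e ∷ es) m = (ι m - ι e) * vanishingAt es m

  vanishingAt-∈ : ∀ {es m} → m ∈ es → vanishingAt es m ≡ 0#
  vanishingAt-∈ {e ∷ es} {m} (here refl) = trans (cong (_* vanishingAt es m) (-‿inverseʳ (ι m))) (zeroˡ _)
  vanishingAt-∈ {e ∷ es} {m} (there m∈es) = trans (cong ((ι m - ι e) *_) (vanishingAt-∈ m∈es)) (zeroʳ _)

  ι! : ℕ → F
  ι! zero    = 1#
  ι! (suc n) = ι (suc n) * ι! n

  Δ^-vanishingAt-high : ∀ es r m → length es ℕ.< r → Δ^ r (vanishingAt es) m ≡ 0#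
  Δ^-vanishingAt-high []       (suc zero)    m _ = trans (cong (1# +_) (*-identityʳ _)) (-‿inverseʳ 1#)
  Δ^-vanishingAt-high []       (suc (suc r)) m _ = trans
    (cong₂ (λ a b → a + (- 1#) * b) (Δ^-vanishingAt-high [] (suc r) (suc m) ℕ.z<s) (Δ^-vanishingAt-high [] (suc r) m ℕ.z<s))
    (trans (+-identityˡ _) (zeroʳ _))
  Δ^-vanishingAt-high (e ∷ es) (suc r) m lt = begin
    Δ^ (suc r) (vanishingAt (e ∷ es)) m  ≡⟨ Δ^-Leibniz r (ι e) (vanishingAt es) m ⟩
    _  ≡⟨ cong₂ (λ a b → (ι m - ι e) * a + ι (suc r) * b)
            (Δ^-vanishingAt-high es (suc r) m (ℕ.<-trans (ℕ.n<1+n _) lt))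
            (Δ^-vanishingAt-high es r (suc m) (ℕ.s<s⁻¹ lt)) ⟩
    (ι m - ι e) * 0# + ι (suc r) * 0#
      ≡⟨ solve 2 (λ a b → a :* con (0 , 0) :+ b :* con (0 , 0) := con (0 , 0)) refl _ _ ⟩
    0# ∎

  -- `vanishingAt es` is a monic polynomial in ι m of degree |es|; its difference of that order is
  -- the constant factorial.
  Δ^-vanishingAt : ∀ es m → Δ^ (length es) (vanishingAt es) m ≡ ι! (length es)
  Δ^-vanishingAt []       m = refl
  Δ^-vanishingAt (e ∷ es) m = begin
    Δ^ (suc r) (vanishingAt (e ∷ es)) m  ≡⟨ Δ^-Leibniz r (ι e) (vanishingAt es) m ⟩
    _  ≡⟨ cong₂ (λ a b → (ι m - ι e) * a + ι (suc r) * b)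
            (Δ^-vanishingAt-high es (suc r) m (ℕ.n<1+n _)) (Δ^-vanishingAt es (suc m)) ⟩
    (ι m - ι e) * 0# + ι (suc r) * ι! r
      ≡⟨ solve 2 (λ a b → a :* con (0 , 0) :+ b := b) refl _ _ ⟩
    ι (suc r) * ι! r ∎
    where r = length es

  pairing-differences : ∀ cs ls w →
    ⟨ leading (map (- 1# ,_) cs ++ ls) , w ⟩ ≡ ⟨ leading ls , Δ^ (length cs) w ⟩
  pairing-differences []       ls w = refl
  pairing-differences (c ∷ cs) ls w = begin
    ⟨ leading ((- 1# , c) ∷ map (- 1# ,_) cs ++ ls) , w ⟩  ≡⟨ pairing-leading (- 1#) c (map (- 1# ,_) cs ++ ls) w ⟩
    ⟨ leading (map (- 1# ,_) cs ++ ls) , Δ w ⟩             ≡⟨ pairing-differences cs ls (Δ w) ⟩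
    ⟨ leading ls , Δ^ (length cs) (Δ w) ⟩                  ≡⟨ pairing-cong (leading ls) (Δ^-Δ (length cs) w) ⟩
    ⟨ leading ls , Δ (Δ^ (length cs) w) ⟩                  ∎

  -- Moved to a constant weight, each factor z + 1 doubles it. The pairing is v times a power of 2.
  pairing-sums-nonzero : 1# + 1# ≢ 0# → ∀ ss w v → (∀ m → w m ≡ v) → v ≢ 0# →
    ⟨ leading (map (1# ,_) ss) , w ⟩ ≢ 0#
  pairing-sums-nonzero 2≢0 [] w v w≡v v≢0 eq = v≢0 (begin
    v                ≡⟨ w≡v 0 ⟨
    w 0              ≡⟨ solve 1 (λ a → a := con (1 , 0) :* a :+ con (0 , 0)) refl (w 0) ⟩
    1# * w 0 + 0#    ≡⟨ eq ⟩
    0#               ∎)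
  pairing-sums-nonzero 2≢0 (s ∷ ss) w v w≡v v≢0 eq =
    pairing-sums-nonzero 2≢0 ss (λ m → w (suc m) + 1# * w m) ((1# + 1#) * v)
      (λ m → trans (cong₂ (λ a b → a + 1# * b) (w≡v (suc m)) (w≡v m))
        (solve 1 (λ v → v :+ con (1 , 0) :* v := (con (1 , 0) :+ con (1 , 0)) :* v) refl v))
      (*-nonzero 2≢0 v≢0)
      (trans (sym (pairing-leading 1# s (map (1# ,_) ss) w)) eq)

  ι!-nonzero : ∀ n → (∀ m → 0 ℕ.< m → m ℕ.≤ n → ι m ≢ 0#) → 1# ≢ 0# → ι! n ≢ 0#
  ι!-nonzero zero    ι≢0 1≢0 = 1≢0
  ι!-nonzero (suc n) ι≢0 1≢0 = *-nonzero (ι≢0 (suc n) ℕ.z<s ℕ.≤-refl)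
    (ι!-nonzero n (λ m 0<m m≤n → ι≢0 m 0<m (ℕ.m≤n⇒m≤1+n m≤n)) 1≢0)

-- The restricted sumset theorem over a field

module CoverSize
  {F : Set} {_+′_ _*′_ : Op₂ F} { -′_ : Op₁ F} {0′ 1′ : F}
  (isCommutativeRing : IsCommutativeRing _≡_ _+′_ _*′_ -′_ 0′ 1′)
  (inv : F → F) (inv-inverse : ∀ x → x ≢ 0′ → inv x *′ x ≡ 1′)
  where
  open PolynomialMethod isCommutativeRing inv inv-inverse
  open CommutativeRing R using (_+_; _*_; -_; _-_; 0#; 1#)
  open CommutativeRing R using (zeroˡ; zeroʳ; +-identityʳ)
  open import Algebra.Properties.Ring (CommutativeRing.ring R) using (-‿injective; -‿involutive)
  open DifferenceSolver R

  ∈-take : ∀ {X : Set} m {x} {xs : List X} → x ∈ take m xs → x ∈ xs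
  ∈-take (suc m) {xs = _ ∷ _} (here eq)  = here eq
  ∈-take (suc m) {xs = _ ∷ _} (there x∈) = there (∈-take m x∈)

  length-take-≤ : ∀ {X : Set} m (xs : List X) → m ℕ.≤ length xs → length (take m xs) ≡ m
  length-take-≤ m xs m≤ = trans (length-take m xs) (ℕ.m≤n⇒m⊓n≡m m≤)

  cover-forms : List F → List F → List (F × F)
  cover-forms cs ss = map (- 1# ,_) cs ++ map (1# ,_) ss

  form-∈ : ∀ ls {l} u v → l ∈ ls → form l u v ≡ 0# → forms ls u v ≡ 0#
  form-∈ (l ∷ ls) u v (here refl) eq = trans (cong (_* forms ls u v) eq) (zeroˡ _)
  form-∈ (l ∷ ls) u v (there l∈)  eq = trans (cong (form l u v *_) (form-∈ ls u v l∈ eq)) (zeroʳ _)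

  cover-forms-vanish : ∀ cs ss u v → u - v ∈ cs ⊎ u + v ∈ ss → forms (cover-forms cs ss) u v ≡ 0#
  cover-forms-vanish cs ss u v (inj₁ ∈cs) = form-∈ _ u v (∈-++⁺ˡ (∈-map⁺ (- 1# ,_) ∈cs))
    (solve 2 (λ u v → (u :+ (:- con (1 , 0)) :* v) :- (u :- v) := con (0 , 0)) refl u v)
  cover-forms-vanish cs ss u v (inj₂ ∈ss) = form-∈ _ u v (∈-++⁺ʳ (map (- 1# ,_) cs) (∈-map⁺ (1# ,_) ∈ss))
    (solve 2 (λ u v → (u :+ con (1 , 0) :* v) :- (u :+ v) := con (0 , 0)) refl u v)

  -- The product of the cover forms has degree M + N + k and vanishes on as × bs, so
  -- its divided differences give k + 1 consecutive zero coefficients in the leading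
  -- form (z - 1)^(M+N) (z + 1)^k. Pairing that form with the weight whose roots are
  -- the M + N remaining exponents yields 2^k (M+N)!, so it cannot vanish.
  no-small-cover : ∀ M N {as bs cs ss : List F} → Unique as → Unique bs →
    length as ≡ suc (M ℕ.+ length ss) → length bs ≡ suc (N ℕ.+ length ss) → length cs ≡ M ℕ.+ N →
    (∀ m → 0 ℕ.< m → m ℕ.≤ M ℕ.+ N → ι m ≢ 0#) → 1# ≢ 0# → 1# + 1# ≢ 0# →
    (∀ {u v} → u ∈ as → v ∈ bs → u - v ∈ cs ⊎ u + v ∈ ss) → ⊥
  no-small-cover M N {x ∷ as} {y ∷ bs} {cs} {ss} ua ub |as| |bs| |cs| ι≢0 1≢0 2≢0 cover =
    pairing-sums-nonzero 2≢0 ss (Δ^ (length cs) w) (ι! (length cs)) Δw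
      (ι!-nonzero (length cs) (λ m 0<m m≤ → ι≢0 m 0<m (subst (m ℕ.≤_) |cs| m≤)) 1≢0)
      (trans (sym (pairing-differences cs (map (1# ,_) ss) w))
        (pairing-vanish (leading ls) w coefficient))
    where
    k d : ℕ
    k = length ss
    d = M ℕ.+ N ℕ.+ k
    ls : List (F × F)
    ls = cover-forms cs ss
    exponents : List ℕ
    exponents = upTo M ++ map (suc (M ℕ.+ k) ℕ.+_) (upTo N)
    w : ℕ → F
    w = vanishingAt exponents
    |exponents| : length exponents ≡ length cs
    |exponents| = trans (length-++ (upTo M)) (trans (cong₂ ℕ._+_ (length-upTo M)
      (trans (length-map _ (upTo N)) (length-upTo N))) (sym |cs|))
    Δw : ∀ m → Δ^ (length cs) w m ≡ ι! (length cs)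
    Δw m = subst (λ n → Δ^ n w m ≡ ι! n) |exponents| (Δ^-vanishingAt exponents m)
    |ls| : length ls ≡ d
    |ls| = trans (length-++ (map (- 1# ,_) cs)) (cong₂ ℕ._+_ (trans (length-map _ cs) |cs|) (length-map _ ss))
    coefficient : ∀ m → nth (leading ls) m ≡ 0# ⊎ w m ≡ 0#
    coefficient m with m ℕ.<? M | m ℕ.≤? M ℕ.+ k | m ℕ.≤? d
    ... | yes m<M | _ | _ = inj₂ (vanishingAt-∈ (∈-++⁺ˡ (∈-upTo⁺ m<M)))
    ... | no _ | _ | no m≰d = inj₁ (nth-beyond (leading ls) m
      (subst (ℕ._≤ m) (sym (trans (length-leading ls) (cong suc |ls|))) (ℕ.≰⇒> m≰d)))
    ... | no _ | no m≰M+k | yes m≤d = inj₂ (vanishingAt-∈ (∈-++⁺ʳ (upTo M)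
      (subst (_∈ map (suc (M ℕ.+ k) ℕ.+_) (upTo N)) (ℕ.m+[n∸m]≡n (ℕ.≰⇒> m≰M+k))
        (∈-map⁺ (suc (M ℕ.+ k) ℕ.+_) (∈-upTo⁺ gap)))))
      where
      gap : m ℕ.∸ suc (M ℕ.+ k) ℕ.< N
      gap = ℕ.+-cancelˡ-≤ (M ℕ.+ k) _ _ (begin
        M ℕ.+ k ℕ.+ suc (m ℕ.∸ suc (M ℕ.+ k))  ≡⟨ ℕ.+-suc (M ℕ.+ k) _ ⟩
        suc (M ℕ.+ k) ℕ.+ (m ℕ.∸ suc (M ℕ.+ k)) ≡⟨ ℕ.m+[n∸m]≡n (ℕ.≰⇒> m≰M+k) ⟩
        m                                       ≤⟨ m≤d ⟩
        M ℕ.+ N ℕ.+ k                           ≡⟨ ℕ.+-assoc M N k ⟩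
        M ℕ.+ (N ℕ.+ k)                         ≡⟨ cong (M ℕ.+_) (ℕ.+-comm N k) ⟩
        M ℕ.+ (k ℕ.+ N)                         ≡⟨ ℕ.+-assoc M k N ⟨
        M ℕ.+ k ℕ.+ N                           ∎)
        where open ℕ.≤-Reasoning
    -- These are the exponents that w leaves uncovered. For them m + 1 points of the first list and
    -- d - m + 1 points of the second are available, and on that grid the product of forms is zero.
    ... | no m≮M | yes m≤M+k | yes m≤d = inj₁ (begin
      nth (leading ls) m                ≡⟨ cong (nth (leading ls)) |xs| ⟨
      nth (leading ls) (length xs)      ≡⟨ Φ-forms-leading ls x xs y ys (Unique.take⁺ (suc m) ua) (Unique.take⁺ (suc n) ub)
                                             (trans |ls| (sym (trans (cong₂ ℕ._+_ |xs| |ys|) (ℕ.m+[n∸m]≡n m≤d)))) ⟨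
      Φ (forms ls) x xs y ys            ≡⟨ Φ-vanish (forms ls) x xs y ys (λ u∈ v∈ →
                                             cover-forms-vanish cs ss _ _ (cover (∈-take (suc m) u∈) (∈-take (suc n) v∈))) ⟩
      0#                                ∎)
      where
      open ≡-Reasoning
      n : ℕ
      n = d ℕ.∸ m
      xs ys : List F
      xs = take m as
      ys = take n bs
      |xs| : length xs ≡ m
      |xs| = length-take-≤ m as (subst (m ℕ.≤_) (sym (ℕ.suc-injective |as|)) m≤M+k)
      |ys| : length ys ≡ n
      |ys| = length-take-≤ n bs (subst (n ℕ.≤_) (sym (ℕ.suc-injective |bs|))
        (ℕ.≤-trans (ℕ.∸-monoʳ-≤ d (ℕ.≮⇒≥ m≮M)) (ℕ.≤-reflexive
          (trans (cong (ℕ._∸ M) (ℕ.+-assoc M N k)) (ℕ.m+n∸m≡n M (N ℕ.+ k))))))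

  private
    regroup₁ : ∀ k c → suc (k ℕ.+ (k ℕ.+ c)) ≡ c ℕ.+ suc (2 ℕ.* k)
    regroup₁ = solve-∀
    regroup₂ : ∀ k c → c ℕ.+ (suc k ℕ.+ suc k) ≡ suc (c ℕ.+ suc (2 ℕ.* k))
    regroup₂ = solve-∀
    regroup₃ : ∀ k m n → (m ℕ.+ suc k) ℕ.+ (n ℕ.+ suc k) ≡ (m ℕ.+ n) ℕ.+ (suc k ℕ.+ suc k)
    regroup₃ = solve-∀

  -- If both alternatives fail, |as| and |bs| exceed k, and the excesses |as| - k - 1 and |bs| - k -
  -- 1 add up to at least c. So c splits as M + N within these excesses, and truncated lists have
  -- exactly the lengths that `no-small-cover` refutes.
  cover-size : ∀ q → (∀ m → 0 ℕ.< m → m ℕ.< q → ι m ≢ 0#) → 2 ℕ.< q →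
    (as bs cs ss : List F) → Unique as → Unique bs → 0 ℕ.< length as → 0 ℕ.< length bs →
    (∀ {u v} → u ∈ as → v ∈ bs → u - v ∈ ss ⊎ u + v ∈ cs) →
    q ℕ.≤ length cs ⊎ length as ℕ.+ length bs ℕ.≤ length cs ℕ.+ suc (2 ℕ.* length ss)
  cover-size q ι≢0 2<q as@(a ∷ _) bs@(b ∷ _) cs ss ua ub _ _ cover
    with q ℕ.≤? length cs | length as ℕ.+ length bs ℕ.≤? length cs ℕ.+ suc (2 ℕ.* length ss)
  ... | yes q≤ | _      = inj₁ q≤
  ... | no _   | yes le = inj₂ le
  -- The second list is negated so that sums become differences. The forms of `cs` then contribute
  -- the factors z - 1, whose number c < q keeps the factorial non-zero, and those of `ss` the
  -- factors z + 1.
  ... | no q≰  | no ≰   = ⊥-elim (no-small-cover M N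
      (Unique.take⁺ (suc (M ℕ.+ k)) ua) (Unique.take⁺ (suc (N ℕ.+ k)) (Unique.map⁺ -‿injective ub))
      (length-take-≤ _ as (fits k<|as| M≤))
      (length-take-≤ _ (map -_ bs) (subst (suc (N ℕ.+ k) ℕ.≤_) (sym (length-map -_ bs)) (fits k<|bs| N≤)))
      (sym M+N≡c)
      (λ m 0<m m≤ → ι≢0 m 0<m (ℕ.≤-<-trans (ℕ.≤-trans m≤ (ℕ.≤-reflexive M+N≡c)) (ℕ.≰⇒> q≰)))
      (λ 1≡0 → ι≢0 1 ℕ.z<s (ℕ.<-trans (ℕ.n<1+n 1) 2<q) (trans (+-identityʳ 1#) 1≡0))
      (λ 2≡0 → ι≢0 2 ℕ.z<s 2<q (trans (cong (1# +_) (+-identityʳ 1#)) 2≡0))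
      λ u∈ v∈ → negated (∈-take _ u∈) (∈-map⁻ -_ (∈-take _ v∈)))
    where
    k c M N : ℕ
    k = length ss
    c = length cs
    -- M takes as much of c as the first list allows; `c≤` guarantees that the second list has room
    -- for the remainder N.
    M = (length as ℕ.∸ suc k) ℕ.⊓ c
    N = c ℕ.∸ M
    negated : ∀ {u v} → u ∈ as → ∃ (λ b → b ∈ bs × v ≡ - b) → u - v ∈ cs ⊎ u + v ∈ ss
    negated u∈ (b , b∈ , refl) with cover u∈ b∈
    ... | inj₁ ∈ss = inj₂ ∈ss
    ... | inj₂ ∈cs = inj₁ (subst (λ z → _ + z ∈ cs) (sym (-‿involutive b)) ∈cs)
    |bs|≤ : length bs ℕ.≤ k ℕ.+ c
    |bs|≤ = length-≤-images (λ s → a - s) (λ c → c - a) ub λ {v} v∈ → case cover (here refl) v∈ of λ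
      { (inj₁ ∈ss) → inj₁ (a - v , ∈ss , solve 2 (λ a v → v := a :- (a :- v)) refl a v)
      ; (inj₂ ∈cs) → inj₂ (a + v , ∈cs , solve 2 (λ a v → v := (a :+ v) :- a) refl a v) }
    |as|≤ : length as ℕ.≤ k ℕ.+ c
    |as|≤ = length-≤-images (λ s → s + b) (λ c → c - b) ua λ {u} u∈ → case cover u∈ (here refl) of λ
      { (inj₁ ∈ss) → inj₁ (u - b , ∈ss , solve 2 (λ u b → u := (u :- b) :+ b) refl u b)
      ; (inj₂ ∈cs) → inj₂ (u + b , ∈cs , solve 2 (λ u b → u := (u :+ b) :- b) refl u b) }
    too-small : ∀ {x y} → x ℕ.≤ k → y ℕ.≤ k ℕ.+ c → x ℕ.+ y ℕ.≤ c ℕ.+ suc (2 ℕ.* k)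
    too-small {x} {y} x≤ y≤ = begin
      x ℕ.+ y               ≤⟨ ℕ.+-mono-≤ x≤ y≤ ⟩
      k ℕ.+ (k ℕ.+ c)       ≤⟨ ℕ.n≤1+n _ ⟩
      suc (k ℕ.+ (k ℕ.+ c)) ≡⟨ regroup₁ k c ⟩
      c ℕ.+ suc (2 ℕ.* k)   ∎
      where open ℕ.≤-Reasoning
    k<|as| : k ℕ.< length as
    k<|as| = ℕ.≰⇒> λ le → ≰ (too-small le |bs|≤)
    k<|bs| : k ℕ.< length bs
    k<|bs| = ℕ.≰⇒> λ le → ≰ (subst (ℕ._≤ c ℕ.+ suc (2 ℕ.* k)) (ℕ.+-comm (length bs) (length as)) (too-small le |as|≤))
    fits : ∀ {n m} → k ℕ.< n → m ℕ.≤ n ℕ.∸ suc k → suc (m ℕ.+ k) ℕ.≤ n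
    fits {n} {m} k<n m≤ = subst₂ ℕ._≤_ (ℕ.+-suc m k) (ℕ.m∸n+n≡m k<n) (ℕ.+-monoˡ-≤ (suc k) m≤)
    c≤ : c ℕ.≤ (length as ℕ.∸ suc k) ℕ.+ (length bs ℕ.∸ suc k)
    c≤ = ℕ.+-cancelʳ-≤ (suc k ℕ.+ suc k) _ _ (begin
      c ℕ.+ (suc k ℕ.+ suc k)    ≡⟨ regroup₂ k c ⟩
      suc (c ℕ.+ suc (2 ℕ.* k))  ≤⟨ ℕ.≰⇒> ≰ ⟩
      length as ℕ.+ length bs    ≡⟨ cong₂ ℕ._+_ (ℕ.m∸n+n≡m k<|as|) (ℕ.m∸n+n≡m k<|bs|) ⟨
      (M′ ℕ.+ suc k) ℕ.+ (N′ ℕ.+ suc k) ≡⟨ regroup₃ k M′ N′ ⟩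
      (M′ ℕ.+ N′) ℕ.+ (suc k ℕ.+ suc k) ∎)
      where
      open ℕ.≤-Reasoning
      M′ N′ : ℕ
      M′ = length as ℕ.∸ suc k
      N′ = length bs ℕ.∸ suc k
    M≤ : M ℕ.≤ length as ℕ.∸ suc k
    M≤ = ℕ.m⊓n≤m _ c
    M+N≡c : M ℕ.+ N ≡ c
    M+N≡c = ℕ.m+[n∸m]≡n (ℕ.m⊓n≤n (length as ℕ.∸ suc k) c)
    N≤ : N ℕ.≤ length bs ℕ.∸ suc k
    N≤ with ℕ.≤-total (length as ℕ.∸ suc k) c
    ... | inj₁ ≤c = subst (λ M → c ℕ.∸ M ℕ.≤ _) (sym (ℕ.m≤n⇒m⊓n≡m ≤c)) (ℕ.m≤n+o⇒m∸n≤o c _ c≤)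
    ... | inj₂ c≤M′ = subst (λ M → c ℕ.∸ M ℕ.≤ _) (sym (ℕ.m≥n⇒m⊓n≡n c≤M′))
      (subst (ℕ._≤ length bs ℕ.∸ suc k) (sym (ℕ.n∸n≡0 c)) z≤n)

-- The ring ℤ/q, and its inverses for prime q

module Modular (q : ℕ) .{{_ : NonZero q}} where

  infixl 6 _⊕_
  infixl 7 _⊗_
  infix 8 ⊖_

  [_] : ℕ → Fin q
  [ m ] = m mod q

  _⊕_ _⊗_ : Fin q → Fin q → Fin q
  x ⊕ y = [ toℕ x ℕ.+ toℕ y ]
  x ⊗ y = [ toℕ x ℕ.* toℕ y ]

  ⊖_ : Fin q → Fin q
  ⊖ x = [ q ℕ.∸ toℕ x ]

  toℕ-[] : ∀ m → toℕ [ m ] ≡ m % q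
  toℕ-[] m = Fin.toℕ-fromℕ< (m%n<n m q)

  []-cong : ∀ {m n} → m % q ≡ n % q → [ m ] ≡ [ n ]
  []-cong {m} {n} eq = Fin.toℕ-injective (trans (toℕ-[] m) (trans eq (sym (toℕ-[] n))))

  []-toℕ : ∀ x → [ toℕ x ] ≡ x
  []-toℕ x = Fin.toℕ-injective (trans (toℕ-[] (toℕ x)) (m<n⇒m%n≡m (Fin.toℕ<n x)))

  []-+ : ∀ m n → [ m ] ⊕ [ n ] ≡ [ m ℕ.+ n ]
  []-+ m n = trans (cong₂ (λ a b → [ a ℕ.+ b ]) (toℕ-[] m) (toℕ-[] n)) ([]-cong (sym (%-distribˡ-+ m n q)))

  []-* : ∀ m n → [ m ] ⊗ [ n ] ≡ [ m ℕ.* n ]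
  []-* m n = trans (cong₂ (λ a b → [ a ℕ.* b ]) (toℕ-[] m) (toℕ-[] n)) ([]-cong (sym (%-distribˡ-* m n q)))

  [q]≡[0] : [ q ] ≡ [ 0 ]
  [q]≡[0] = []-cong (trans (n%n≡0 q) (sym (m<n⇒m%n≡m (ℕ.>-nonZero⁻¹ q))))

  ⊕-comm : ∀ x y → x ⊕ y ≡ y ⊕ x
  ⊕-comm x y = cong [_] (ℕ.+-comm (toℕ x) (toℕ y))

  ⊗-comm : ∀ x y → x ⊗ y ≡ y ⊗ x
  ⊗-comm x y = cong [_] (ℕ.*-comm (toℕ x) (toℕ y))

  ⊕-identityˡ : ∀ x → [ 0 ] ⊕ x ≡ x
  ⊕-identityˡ x = trans (cong ([ 0 ] ⊕_) (sym ([]-toℕ x))) (trans ([]-+ 0 (toℕ x)) ([]-toℕ x))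

  ⊗-identityˡ : ∀ x → [ 1 ] ⊗ x ≡ x
  ⊗-identityˡ x = trans (cong ([ 1 ] ⊗_) (sym ([]-toℕ x)))
    (trans ([]-* 1 (toℕ x)) (trans (cong [_] (ℕ.*-identityˡ (toℕ x))) ([]-toℕ x)))

  ⊖-inverseʳ : ∀ x → x ⊕ ⊖ x ≡ [ 0 ]
  ⊖-inverseʳ x = trans (cong (_⊕ ⊖ x) (sym ([]-toℕ x))) (trans ([]-+ (toℕ x) _)
    (trans (cong [_] (ℕ.m+[n∸m]≡n (ℕ.<⇒≤ (Fin.toℕ<n x)))) [q]≡[0]))

  ⊕-assoc : ∀ x y z → (x ⊕ y) ⊕ z ≡ x ⊕ (y ⊕ z)
  ⊕-assoc x y z = begin
    [ a ℕ.+ b ] ⊕ z         ≡⟨ cong ([ a ℕ.+ b ] ⊕_) ([]-toℕ z) ⟨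
    [ a ℕ.+ b ] ⊕ [ c ]     ≡⟨ []-+ (a ℕ.+ b) c ⟩
    [ a ℕ.+ b ℕ.+ c ]       ≡⟨ cong [_] (ℕ.+-assoc a b c) ⟩
    [ a ℕ.+ (b ℕ.+ c) ]     ≡⟨ []-+ a (b ℕ.+ c) ⟨
    [ a ] ⊕ [ b ℕ.+ c ]     ≡⟨ cong (_⊕ [ b ℕ.+ c ]) ([]-toℕ x) ⟩
    x ⊕ [ b ℕ.+ c ]         ∎
    where
    open ≡-Reasoning
    a b c : ℕ
    a = toℕ x
    b = toℕ y
    c = toℕ z

  ⊗-assoc : ∀ x y z → (x ⊗ y) ⊗ z ≡ x ⊗ (y ⊗ z)
  ⊗-assoc x y z = begin
    [ a ℕ.* b ] ⊗ z         ≡⟨ cong ([ a ℕ.* b ] ⊗_) ([]-toℕ z) ⟨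
    [ a ℕ.* b ] ⊗ [ c ]     ≡⟨ []-* (a ℕ.* b) c ⟩
    [ a ℕ.* b ℕ.* c ]       ≡⟨ cong [_] (ℕ.*-assoc a b c) ⟩
    [ a ℕ.* (b ℕ.* c) ]     ≡⟨ []-* a (b ℕ.* c) ⟨
    [ a ] ⊗ [ b ℕ.* c ]     ≡⟨ cong (_⊗ [ b ℕ.* c ]) ([]-toℕ x) ⟩
    x ⊗ [ b ℕ.* c ]         ∎
    where
    open ≡-Reasoning
    a b c : ℕ
    a = toℕ x
    b = toℕ y
    c = toℕ z

  ⊗-distribˡ-⊕ : ∀ x y z → x ⊗ (y ⊕ z) ≡ (x ⊗ y) ⊕ (x ⊗ z)
  ⊗-distribˡ-⊕ x y z = begin
    x ⊗ [ b ℕ.+ c ]                 ≡⟨ cong (_⊗ [ b ℕ.+ c ]) ([]-toℕ x) ⟨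
    [ a ] ⊗ [ b ℕ.+ c ]             ≡⟨ []-* a (b ℕ.+ c) ⟩
    [ a ℕ.* (b ℕ.+ c) ]             ≡⟨ cong [_] (ℕ.*-distribˡ-+ a b c) ⟩
    [ a ℕ.* b ℕ.+ a ℕ.* c ]         ≡⟨ []-+ (a ℕ.* b) (a ℕ.* c) ⟨
    [ a ℕ.* b ] ⊕ [ a ℕ.* c ]       ∎
    where
    open ≡-Reasoning
    a b c : ℕ
    a = toℕ x
    b = toℕ y
    c = toℕ z

  isCommutativeRing : IsCommutativeRing _≡_ _⊕_ _⊗_ ⊖_ [ 0 ] [ 1 ]
  isCommutativeRing = record
    { isRing = record
      { +-isAbelianGroup = record
        { isGroup = record
          { isMonoid = record
            { isSemigroup = record
              { isMagma = record { isEquivalence = isEquivalence ; ∙-cong = cong₂ _⊕_ }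
              ; assoc = ⊕-assoc
              }
            ; identity = ⊕-identityˡ , λ x → trans (⊕-comm x [ 0 ]) (⊕-identityˡ x)
            }
          ; inverse = (λ x → trans (⊕-comm (⊖ x) x) (⊖-inverseʳ x)) , ⊖-inverseʳ
          ; ⁻¹-cong = cong ⊖_
          }
        ; comm = ⊕-comm
        }
      ; *-cong = cong₂ _⊗_
      ; *-assoc = ⊗-assoc
      ; *-identity = ⊗-identityˡ , λ x → trans (⊗-comm x [ 1 ]) (⊗-identityˡ x)
      ; distrib = ⊗-distribˡ-⊕ , λ x y z →
          trans (⊗-comm (y ⊕ z) x) (trans (⊗-distribˡ-⊕ x y z) (cong₂ _⊕_ (⊗-comm x y) (⊗-comm x z)))
      }
    ; *-comm = ⊗-comm
    }

  ring : CommutativeRing _ _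
  ring = record { isCommutativeRing = isCommutativeRing }

  nonzero⇒0< : ∀ x → x ≢ [ 0 ] → 0 ℕ.< toℕ x
  nonzero⇒0< x x≢0 = ℕ.n≢0⇒n>0 λ eq → x≢0 (trans (sym ([]-toℕ x)) (cong [_] eq))

  module _ (q-prime : Prime q) where
    open import Algebra.Properties.Ring (CommutativeRing.ring ring)

    inverse : ∀ x → x ≢ [ 0 ] → ∃ λ y → y ⊗ x ≡ [ 1 ]
    inverse x x≢0 with coprime-Bézout (Coprimality.sym
      (prime⇒coprime q-prime {{ℕ.>-nonZero (nonzero⇒0< x x≢0)}} (Fin.toℕ<n x)))
    ... | Bézout.+- u v eq = [ u ] , (begin
      [ u ] ⊗ x                     ≡⟨ cong ([ u ] ⊗_) ([]-toℕ x) ⟨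
      [ u ] ⊗ [ toℕ x ]             ≡⟨ []-* u (toℕ x) ⟩
      [ u ℕ.* toℕ x ]               ≡⟨ cong [_] eq ⟨
      [ 1 ℕ.+ v ℕ.* q ]             ≡⟨ []-+ 1 (v ℕ.* q) ⟨
      [ 1 ] ⊕ [ v ℕ.* q ]           ≡⟨ cong ([ 1 ] ⊕_) ([]-cong (trans (m*n%n≡0 v q) (sym (m*n%n≡0 0 q)))) ⟩
      [ 1 ] ⊕ [ 0 ]                 ≡⟨ trans (⊕-comm [ 1 ] [ 0 ]) (⊕-identityˡ [ 1 ]) ⟩
      [ 1 ]                         ∎)
      where open ≡-Reasoning
    ... | Bézout.-+ u v eq = ⊖ [ u ] , (begin
      ⊖ [ u ] ⊗ x                   ≡⟨ -‿distribˡ-* [ u ] x ⟨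
      ⊖ ([ u ] ⊗ x)                 ≡⟨ +-inverseˡ-unique [ 1 ] ([ u ] ⊗ x) (begin
        [ 1 ] ⊕ [ u ] ⊗ x           ≡⟨ cong (λ z → [ 1 ] ⊕ [ u ] ⊗ z) ([]-toℕ x) ⟨
        [ 1 ] ⊕ [ u ] ⊗ [ toℕ x ]   ≡⟨ cong ([ 1 ] ⊕_) ([]-* u (toℕ x)) ⟩
        [ 1 ] ⊕ [ u ℕ.* toℕ x ]     ≡⟨ []-+ 1 _ ⟩
        [ 1 ℕ.+ u ℕ.* toℕ x ]       ≡⟨ cong [_] eq ⟩
        [ v ℕ.* q ]                 ≡⟨ []-cong (trans (m*n%n≡0 v q) (sym (m*n%n≡0 0 q))) ⟩
        [ 0 ]                       ∎) ⟨
      [ 1 ]                         ∎)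
      where open ≡-Reasoning

    inv : Fin q → Fin q
    inv x with x Fin.≟ [ 0 ]
    ... | yes _   = [ 0 ]
    ... | no x≢0 = proj₁ (inverse x x≢0)

    inv-inverse : ∀ x → x ≢ [ 0 ] → inv x ⊗ x ≡ [ 1 ]
    inv-inverse x x≢0 with x Fin.≟ [ 0 ]
    ... | yes x≡0  = contradiction x≡0 x≢0
    ... | no x≢0′ = proj₂ (inverse x x≢0′)

    open PolynomialMethod isCommutativeRing inv inv-inverse using (ι)

    ι≡[] : ∀ m → ι m ≡ [ m ]
    ι≡[] zero    = refl
    ι≡[] (suc m) = trans (cong ([ 1 ] ⊕_) (ι≡[] m)) ([]-+ 1 m)

    ι-nonzero : ∀ m → 0 ℕ.< m → m ℕ.< q → ι m ≢ [ 0 ]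
    ι-nonzero m 0<m m<q eq = ℕ.<⇒≢ 0<m (begin
      0          ≡⟨ m<n⇒m%n≡m (ℕ.>-nonZero⁻¹ q) ⟨
      0 % q      ≡⟨ toℕ-[] 0 ⟨
      toℕ [ 0 ]  ≡⟨ cong toℕ (trans (sym (ι≡[] m)) eq) ⟨
      toℕ [ m ]  ≡⟨ toℕ-[] m ⟩
      m % q      ≡⟨ m<n⇒m%n≡m m<q ⟩
      m          ∎)
      where open ≡-Reasoning

    modular-cover-size : 2 ℕ.< q →
      (as bs cs ss : List (Fin q)) → Unique as → Unique bs → 0 ℕ.< length as → 0 ℕ.< length bs →
      (∀ {u v} → u ∈ as → v ∈ bs → u ⊕ ⊖ v ∈ ss ⊎ u ⊕ v ∈ cs) →
      q ℕ.≤ length cs ⊎ length as ℕ.+ length bs ℕ.≤ length cs ℕ.+ suc (2 ℕ.* length ss)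
    modular-cover-size = CoverSize.cover-size isCommutativeRing inv inv-inverse q ι-nonzero

-- Sums over classes and the inequalities between them

module Counting where
  open import Data.Nat using (_+_; _*_; _∸_)

  -- Sums and supports of functions on Fin n

  sum-mono : ∀ {n} {f g : Fin n → ℕ} → (∀ i → f i ≤ g i) → sum f ≤ sum g
  sum-mono {zero}  f≤g = z≤n
  sum-mono {suc n} f≤g = ℕ.+-mono-≤ (f≤g zero) (sum-mono (f≤g ∘ suc))

  sum-mono-< : ∀ {n} {f g : Fin n → ℕ} k → (∀ i → f i ≤ g i) → f k < g k → sum f < sum g
  sum-mono-< zero    f≤g f<g = ℕ.+-mono-<-≤ f<g (sum-mono (f≤g ∘ suc))
  sum-mono-< (suc k) f≤g f<g = ℕ.+-mono-≤-< (f≤g zero) (sum-mono-< k (f≤g ∘ suc) f<g)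

  term≤sum : ∀ {n} (f : Fin n → ℕ) k → f k ≤ sum f
  term≤sum f zero    = ℕ.m≤m+n _ _
  term≤sum f (suc k) = ℕ.≤-trans (term≤sum (f ∘ suc) k) (ℕ.m≤n+m _ _)

  maximum : ∀ {n} (f : Fin n → ℕ) → Fin n → ∃ λ i → ∀ j → f j ≤ f i
  maximum {suc zero}    f _ = zero , λ { zero → ℕ.≤-refl }
  maximum {suc (suc n)} f _ with maximum (f ∘ suc) zero
  ... | i , max with ℕ.≤-total (f zero) (f (suc i))
  ...   | inj₁ f0≤ = suc i , λ { zero → f0≤ ; (suc j) → max j }
  ...   | inj₂ ≤f0 = zero , λ { zero → ℕ.≤-refl ; (suc j) → ℕ.≤-trans (max j) ≤f0 }

  sum-positive : ∀ {n} (f : Fin n → ℕ) → 0 < sum f → ∃ λ i → 0 < f i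
  sum-positive {suc n} f 0<Σ with f zero in eq
  ... | suc _ = zero , subst (0 <_) (sym eq) ℕ.z<s
  ... | zero with sum-positive (f ∘ suc) 0<Σ
  ...   | i , 0<fi = suc i , 0<fi

  sgn : ℕ → ℕ
  sgn zero    = 0
  sgn (suc _) = 1

  # : ∀ {n} → (Fin n → ℕ) → ℕ
  # f = sum (sgn ∘ f)

  sgn≤1 : ∀ m → sgn m ≤ 1
  sgn≤1 zero    = z≤n
  sgn≤1 (suc m) = ℕ.≤-refl

  sgn≤ : ∀ m → sgn m ≤ m
  sgn≤ zero    = z≤n
  sgn≤ (suc m) = s≤s z≤n

  sgn+pred : ∀ m → m ≡ sgn m + (m ∸ 1)
  sgn+pred zero    = refl
  sgn+pred (suc m) = refl

  support : ∀ {n} → (Fin n → ℕ) → List (Fin n)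
  support {n} f = filter (λ i → 0 ℕ.<? f i) (allFin n)

  ∈-support : ∀ {n} (f : Fin n → ℕ) {i} → 0 < f i → i ∈ support f
  ∈-support f 0<fi = ∈-filter⁺ (λ i → 0 ℕ.<? f i) (∈-allFin _) 0<fi

  support-∈ : ∀ {n} (f : Fin n → ℕ) {i} → i ∈ support f → 0 < f i
  support-∈ {n} f i∈ = proj₂ (∈-filter⁻ (λ i → 0 ℕ.<? f i) {xs = allFin n} i∈)

  length-support : ∀ {n} (f : Fin n → ℕ) → length (support f) ≡ # f
  length-support f = go (λ i → i)
    where
    go : ∀ {m} (e : Fin m → _) → length (filter (λ i → 0 ℕ.<? f i) (tabulate e)) ≡ sum (λ i → sgn (f (e i)))
    go {zero}  e = refl
    go {suc m} e with f (e zero)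
    ... | zero  = go (e ∘ suc)
    ... | suc _ = cong suc (go (e ∘ suc))

  -- Arithmetic of the counting argument

  module Arithmetic where
    -- Here K = |S| and s counts the classes that S meets. The constant 1 from the ℤ/q theorem is
    -- paid by s if S is non-empty, and by the maximum with 1 otherwise.
    slack : ∀ K s → (s ≡ 0 → K ≡ 0) → 1 + 3 * K ≤ s + (1 ⊔ 3 * K)
    slack K zero    K≡0 rewrite K≡0 refl = ℕ.≤-refl
    slack K (suc s) _ = s≤s (ℕ.≤-trans (ℕ.m≤n⊔m 1 (3 * K)) (ℕ.m≤n+m _ s))

    suc≤1⊔3* : ∀ K → 1 + K ≤ 1 ⊔ 3 * K
    suc≤1⊔3* zero    = ℕ.≤-refl
    suc≤1⊔3* (suc K) = begin
      suc (suc K)                ≤⟨ ℕ.m≤m+n _ (suc (2 * K)) ⟩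
      suc (suc K) + suc (2 * K)  ≡⟨ regroup K ⟩
      3 * suc K                  ≤⟨ ℕ.m≤n⊔m 1 (3 * suc K) ⟩
      1 ⊔ 3 * suc K              ∎
      where
      open ℕ.≤-Reasoning
      regroup : ∀ K → suc (suc K) + suc (2 * K) ≡ 3 * suc K
      regroup = solve-∀

    -- A, B, K are the sums of f, g, σ, and a, b, N, s their numbers of non-empty classes together
    -- with that of T (N). The counts above the threshold are aα for f and sα for σ, and W = Σ (T ∸
    -- 1). Adding `columns`, `classes` and `layers` cancels α b and 2 sα; a ≤ b is what lets the
    -- layers of f be charged to the classes of g.
    total-tall : ∀ A B a b aα N W K s sα α →
      suc α * b + B + 2 * sα + s ≤ W + 2 * b + 3 * K →
      aα + b ≤ N + suc (2 * sα) →
      A ≤ α * a + aα → a ≤ b →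
      1 + 3 * K ≤ s + (1 ⊔ 3 * K) →
      A + B ≤ (N + W) + (1 ⊔ 3 * K)
    total-tall A B a b aα N W K s sα α columns classes layers a≤b slack =
      ℕ.+-cancelʳ-≤ (s + b + α * b + 2 * sα + b) _ _ (begin
        A + B + (s + b + α * b + 2 * sα + b)                       ≡⟨ regroup₁ A B b s sα α ⟩
        A + b + (suc α * b + B + 2 * sα + s)                       ≤⟨ ℕ.+-mono-≤ (ℕ.+-monoˡ-≤ b (ℕ.≤-trans layers (ℕ.+-monoˡ-≤ aα (ℕ.*-monoʳ-≤ α a≤b)))) columns ⟩
        α * b + aα + b + (W + 2 * b + 3 * K)                       ≡⟨ regroup₂ α b aα W K ⟩
        (aα + b) + (α * b + W + 2 * b + 3 * K)                     ≤⟨ ℕ.+-monoˡ-≤ _ classes ⟩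
        N + suc (2 * sα) + (α * b + W + 2 * b + 3 * K)             ≡⟨ regroup₃ α b N W K sα ⟩
        (N + W) + (1 + 3 * K) + (α * b + 2 * sα + 2 * b)           ≤⟨ ℕ.+-monoˡ-≤ _ (ℕ.+-monoʳ-≤ (N + W) slack) ⟩
        (N + W) + (s + M) + (α * b + 2 * sα + 2 * b)               ≡⟨ regroup₄ (N + W) s M α b sα ⟩
        (N + W) + M + (s + b + α * b + 2 * sα + b)                 ∎)
      where
      open ℕ.≤-Reasoning
      M : ℕ
      M = 1 ⊔ 3 * K
      regroup₁ : ∀ A B b s sα α → A + B + (s + b + α * b + 2 * sα + b) ≡ A + b + (suc α * b + B + 2 * sα + s)
      regroup₁ = solve-∀
      regroup₂ : ∀ α b aα W K → α * b + aα + b + (W + 2 * b + 3 * K) ≡ (aα + b) + (α * b + W + 2 * b + 3 * K)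
      regroup₂ = solve-∀
      regroup₃ : ∀ α b N W K sα →
        N + suc (2 * sα) + (α * b + W + 2 * b + 3 * K) ≡ (N + W) + (1 + 3 * K) + (α * b + 2 * sα + 2 * b)
      regroup₃ = solve-∀
      regroup₄ : ∀ T s M α b sα → T + (s + M) + (α * b + 2 * sα + 2 * b) ≡ T + M + (s + b + α * b + 2 * sα + b)
      regroup₄ = solve-∀

    -- Letters as in `total-tall`, except that s is the number of exceptional classes granted to the
    -- ℤ/q theorem and e is what the columns gain by strictness.
    total-flat : ∀ A B a b N W K s e →
      b + B + e ≤ W + 2 * b + K →
      a + b ≤ N + suc (2 * s) →
      A ≤ a → 1 + 2 * s + K ≤ e + (1 ⊔ 3 * K) →
      A + B ≤ (N + W) + (1 ⊔ 3 * K)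
    total-flat A B a b N W K s e columns classes A≤a slack =
      ℕ.+-cancelʳ-≤ (2 * b + e) _ _ (begin
        A + B + (2 * b + e)                        ≡⟨ regroup₁ A B b e ⟩
        A + b + (b + B + e)                        ≤⟨ ℕ.+-mono-≤ (ℕ.≤-trans (ℕ.+-monoˡ-≤ b A≤a) classes) columns ⟩
        N + suc (2 * s) + (W + 2 * b + K)          ≡⟨ regroup₂ N s W b K ⟩
        (N + W) + 2 * b + (1 + 2 * s + K)          ≤⟨ ℕ.+-monoʳ-≤ ((N + W) + 2 * b) slack ⟩
        (N + W) + 2 * b + (e + M)                  ≡⟨ regroup₃ (N + W) b e M ⟩
        (N + W) + M + (2 * b + e)                  ∎)
      where
      open ℕ.≤-Reasoning
      M : ℕ
      M = 1 ⊔ 3 * K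
      regroup₁ : ∀ A B b e → A + B + (2 * b + e) ≡ A + b + (b + B + e)
      regroup₁ = solve-∀
      regroup₂ : ∀ N s W b K → N + suc (2 * s) + (W + 2 * b + K) ≡ (N + W) + 2 * b + (1 + 2 * s + K)
      regroup₂ = solve-∀
      regroup₃ : ∀ T b e M → T + 2 * b + (e + M) ≡ T + M + (2 * b + e)
      regroup₃ = solve-∀

    -- The contribution of one class j, with g, w, s the fibre sizes of B over j, of C over i₀ + j
    -- and of S over i₀ - j. The left side carries two charges besides the fibre sizes: 2 for a
    -- class of σ above α, due to the ℤ/q theorem, and 1 for a non-empty class of σ, to be spent in
    -- `slack`.
    column-tall : ∀ α g w s → 0 < α → (0 < g → suc α + g ≤ w + (1 ⊔ 3 * s)) → (0 < g → g ≤ w + s) →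
      suc α * sgn g + g + 2 * sgn (s ∸ α) + sgn s ≤ (w ∸ 1) + 2 * sgn g + 3 * s
    column-tall α@(suc _) zero w zero 0<α _ _ rewrite ℕ.*-zeroʳ α = z≤n
    column-tall α zero w (suc s) 0<α _ _ rewrite ℕ.*-zeroʳ α = begin
      2 * sgn (suc s ∸ α) + 1          ≤⟨ ℕ.+-monoˡ-≤ 1 (ℕ.*-monoʳ-≤ 2 (sgn≤1 (suc s ∸ α))) ⟩
      3                                ≤⟨ ℕ.*-monoʳ-≤ 3 {1} {suc s} (s≤s z≤n) ⟩
      3 * suc s                        ≤⟨ ℕ.m≤n+m _ _ ⟩
      (w ∸ 1) + 0 + 3 * suc s          ∎
      where open ℕ.≤-Reasoning
    column-tall α@(suc _) g@(suc _) w zero 0<α ih _ = begin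
      suc α * 1 + g + 0 + 0  ≡⟨ regroup₀ α g ⟩
      suc α + g              ≤⟨ ih ℕ.z<s ⟩
      w + 1                  ≤⟨ ℕ.+-monoˡ-≤ 1 (ℕ.m≤n+m∸n w 1) ⟩
      1 + v + 1              ≡⟨ regroup v ⟩
      v + 2 * 1 + 3 * 0      ∎
      where
      open ℕ.≤-Reasoning
      v = w ∸ 1
      regroup₀ : ∀ α g → suc α * 1 + g + 0 + 0 ≡ suc α + g
      regroup₀ = solve-∀
      regroup : ∀ v → 1 + v + 1 ≡ v + 2 * 1 + 3 * 0
      regroup = solve-∀
    column-tall α g@(suc _) w s@(suc s′) 0<α ih triv with s ℕ.≤? α
    ... | yes s≤α rewrite ℕ.m≤n⇒m∸n≡0 s≤α = begin
      suc α * 1 + g + 0 + 1    ≡⟨ regroup₀ α g ⟩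
      suc α + g + 1            ≤⟨ ℕ.+-monoˡ-≤ 1 (ih ℕ.z<s) ⟩
      w + (1 ⊔ 3 * s) + 1      ≡⟨ cong (λ m → w + m + 1) (ℕ.m≤n⇒m⊔n≡n {1} {3 * s} (s≤s z≤n)) ⟩
      w + 3 * s + 1            ≤⟨ ℕ.+-monoˡ-≤ 1 (ℕ.+-monoˡ-≤ (3 * s) (ℕ.m≤n+m∸n w 1)) ⟩
      1 + v + 3 * s + 1        ≡⟨ regroup v s ⟩
      v + 2 * 1 + 3 * s        ∎
      where
      open ℕ.≤-Reasoning
      v = w ∸ 1
      regroup₀ : ∀ α g → suc α * 1 + g + 0 + 1 ≡ suc α + g + 1
      regroup₀ = solve-∀
      regroup : ∀ v s → 1 + v + 3 * s + 1 ≡ v + 2 * 1 + 3 * s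
      regroup = solve-∀
    -- The inductive bound would fall short by 2 here. Instead suc α ≤ s and g ≤ w + s leave one s
    -- to spare, and s ≥ 2 because α is positive.
    ... | no s≰α = begin
      suc α * 1 + g + 2 * sgn (s ∸ α) + 1  ≤⟨ ℕ.+-monoˡ-≤ 1 (ℕ.+-mono-≤ (ℕ.+-mono-≤ (ℕ.*-monoˡ-≤ 1 (ℕ.≰⇒> s≰α)) (ℕ.≤-trans (triv ℕ.z<s) (ℕ.+-monoˡ-≤ s (ℕ.m≤n+m∸n w 1))))
                                                (ℕ.*-monoʳ-≤ 2 (sgn≤1 (s ∸ α)))) ⟩
      s * 1 + (1 + v + s) + 2 * 1 + 1      ≡⟨ regroup₁ v s ⟩
      v + 2 * 1 + 2 * s + 2                ≤⟨ ℕ.+-monoʳ-≤ (v + 2 * 1 + 2 * s) (ℕ.≤-trans (s≤s 0<α) (ℕ.≰⇒> s≰α)) ⟩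
      v + 2 * 1 + 2 * s + s                ≡⟨ regroup₂ v s ⟩
      v + 2 * 1 + 3 * s                    ∎
      where
      open ℕ.≤-Reasoning
      v = w ∸ 1
      regroup₁ : ∀ v s → s * 1 + (1 + v + s) + 2 * 1 + 1 ≡ v + 2 * 1 + 2 * s + 2
      regroup₁ = solve-∀
      regroup₂ : ∀ v s → v + 2 * 1 + 2 * s + s ≡ v + 2 * 1 + 3 * s
      regroup₂ = solve-∀

    column-flat : ∀ g w s → (0 < g → g ≤ w + s) → sgn g + g ≤ (w ∸ 1) + 2 * sgn g + s
    column-flat zero      w s _    = z≤n
    column-flat g@(suc _) w s triv = begin
      1 + g                ≤⟨ s≤s (ℕ.≤-trans (triv ℕ.z<s) (ℕ.+-monoˡ-≤ s (ℕ.m≤n+m∸n w 1))) ⟩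
      1 + (1 + v + s)      ≡⟨ regroup v s ⟩
      v + 2 * 1 + s        ∎
      where
      open ℕ.≤-Reasoning
      v = w ∸ 1
      regroup : ∀ v s → 1 + (1 + v + s) ≡ v + 2 * 1 + s
      regroup = solve-∀

    -- A fibre of S at least as large as the fibre of B makes w dispensable in the estimate, which
    -- gains 1 over `column-flat`.
    column-flat-< : ∀ g w s → 0 < g → g ≤ s → sgn g + g < (w ∸ 1) + 2 * sgn g + s
    column-flat-< g@(suc _) w s _ g≤s = begin
      2 + g                ≤⟨ ℕ.+-monoʳ-≤ 2 g≤s ⟩
      2 + s                ≤⟨ ℕ.+-monoˡ-≤ s (ℕ.m≤n+m 2 (w ∸ 1)) ⟩
      (w ∸ 1) + 2 * 1 + s  ∎
      where open ℕ.≤-Reasoning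

  open Arithmetic

  -- From fibre sizes over ℤ/q to total sizes

  module FiberSizes (q : ℕ) .{{_ : NonZero q}} (q-prime : Prime q) (2<q : 2 < q) where
    open Modular q
    open DifferenceSolver ring renaming (solve to ring-solve)

    support-cover : (f g σ T : Fin q → ℕ) → ∃ (λ i → 0 < f i) → ∃ (λ j → 0 < g j) →
      (∀ i j → 0 < f i → 0 < g j → 0 < σ (i ⊕ ⊖ j) ⊎ 0 < T (i ⊕ j)) →
      q ≤ # T ⊎ # f + # g ≤ # T + suc (2 * # σ)
    support-cover f g σ T (i , 0<fi) (j , 0<gj) cover
      with modular-cover-size q-prime 2<q (support f) (support g) (support T) (support σ)
        (Unique.filter⁺ _ (Unique.allFin⁺ q)) (Unique.filter⁺ _ (Unique.allFin⁺ q))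
        (∈-length (∈-support f 0<fi)) (∈-length (∈-support g 0<gj))
        (λ u∈ v∈ → Sum.map (∈-support σ) (∈-support T) (cover _ _ (support-∈ f u∈) (support-∈ g v∈)))
    ... | inj₁ q≤ = inj₁ (subst (q ≤_) (length-support T) q≤)
    ... | inj₂ le = inj₂ (subst₂ _≤_ (cong₂ _+_ (length-support f) (length-support g))
      (cong₂ (λ t s → t + suc (2 * s)) (length-support T) (length-support σ)) le)

    sum-translate : ∀ (h : Fin q → ℕ) i → sum (λ j → h (i ⊕ j)) ≡ sum h
    sum-translate h i = sym (sum-permute h (permutation (i ⊕_) (λ j → j ⊕ ⊖ i)
      (λ j → ring-solve 2 (λ i j → i :+ (j :- i) := j) refl i j)
      (λ j → ring-solve 2 (λ i j → (i :+ j) :- i := j) refl i j)))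

    sum-reflect : ∀ (h : Fin q → ℕ) i → sum (λ j → h (i ⊕ ⊖ j)) ≡ sum h
    sum-reflect h i = sym (sum-permute h (permutation (λ j → i ⊕ ⊖ j) (λ j → i ⊕ ⊖ j)
      (λ j → ring-solve 2 (λ i j → i :- (i :- j) := j) refl i j)
      (λ j → ring-solve 2 (λ i j → i :- (i :- j) := j) refl i j)))

    sum-negate : ∀ (h : Fin q → ℕ) → sum (λ j → h (⊖ j)) ≡ sum h
    sum-negate h = trans (sum-cong-≗ λ j → cong h (sym (⊕-identityˡ (⊖ j)))) (sum-reflect h [ 0 ])

    -- f, g, σ and T are the sizes of the fibres of A, B, S and C over ℤ/q.
    record FiberSizes (p : ℕ) (f g σ T : Fin q → ℕ) : Set where
      field
        boundˡ : ∀ i j → 0 < g j → f i ≤ T (i ⊕ j) + σ (i ⊕ ⊖ j)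
        boundʳ : ∀ i j → 0 < f i → g j ≤ T (i ⊕ j) + σ (i ⊕ ⊖ j)
        bound  : ∀ i j → 0 < f i → 0 < g j →
          p ≤ T (i ⊕ j) ⊎ f i + g j ≤ T (i ⊕ j) + (1 ⊔ 3 * σ (i ⊕ ⊖ j))

    -- Exchanging A and B reverses all differences, hence the reflected σ. This justifies assuming
    -- that A meets no more classes than B.
    FiberSizes-swap : ∀ {p f g σ T} → FiberSizes p f g σ T → FiberSizes p g f (σ ∘ ⊖_) T
    FiberSizes-swap {p} {f} {g} {σ} {T} F = record
      { boundˡ = λ j i 0<f → subst₂ (λ t s → g j ≤ T t + σ s) (⊕-comm i j) (flip i j) (boundʳ i j 0<f)
      ; boundʳ = λ j i 0<g → subst₂ (λ t s → f i ≤ T t + σ s) (⊕-comm i j) (flip i j) (boundˡ i j 0<g)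
      ; bound = λ j i 0<g 0<f → subst₂ (λ t s → p ≤ T t ⊎ g j + f i ≤ T t + (1 ⊔ 3 * σ s)) (⊕-comm i j) (flip i j)
          (Sum.map₂ (subst (_≤ T (i ⊕ j) + (1 ⊔ 3 * σ (i ⊕ ⊖ j))) (ℕ.+-comm (f i) (g j))) (bound i j 0<f 0<g))
      }
      where
      open FiberSizes F
      flip : ∀ i j → i ⊕ ⊖ j ≡ ⊖ (j ⊕ ⊖ i)
      flip = ring-solve 2 (λ i j → i :- j := :- (j :- i)) refl

    module _ {p} (p≤q : p ≤ q) {f g σ T : Fin q → ℕ} (sizes : FiberSizes p f g σ T)
      (0<Σf : 0 < sum f) (0<Σg : 0 < sum g) (#f≤#g : # f ≤ # g) (p≰ΣT : ¬ p ≤ sum T) where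
      open FiberSizes sizes

      ΣT : sum T ≡ # T + sum (λ c → T c ∸ 1)
      ΣT = trans (sum-cong-≗ (sgn+pred ∘ T)) (∑-distrib-+ (sgn ∘ T) (λ c → T c ∸ 1))

      #T≤ΣT : # T ≤ sum T
      #T≤ΣT = sum-mono (sgn≤ ∘ T)

      -- The alternative that C meets all q classes would give p ≤ q ≤ |C|. The functions u and s
      -- are left free because different thresholds on f and σ are needed.
      classes : ∀ (u s : Fin q → ℕ) → ∃ (λ i → 0 < u i) →
        (∀ i j → 0 < u i → 0 < g j → 0 < s (i ⊕ ⊖ j) ⊎ 0 < T (i ⊕ j)) →
        # u + # g ≤ # T + suc (2 * # s)
      classes u s ∃u cover with support-cover u g s T ∃u (sum-positive g 0<Σg) cover
      ... | inj₁ q≤ = contradiction (ℕ.≤-trans p≤q (ℕ.≤-trans q≤ #T≤ΣT)) p≰ΣT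
      ... | inj₂ le = le

      bound′ : ∀ i j → 0 < f i → 0 < g j → f i + g j ≤ T (i ⊕ j) + (1 ⊔ 3 * σ (i ⊕ ⊖ j))
      bound′ i j 0<f 0<g with bound i j 0<f 0<g
      ... | inj₁ p≤ = contradiction (ℕ.≤-trans p≤ (term≤sum T _)) p≰ΣT
      ... | inj₂ le = le

      #≡0⇒sum≡0 : # σ ≡ 0 → sum σ ≡ 0
      #≡0⇒sum≡0 #≡0 = ℕ.n≤0⇒n≡0 (ℕ.≮⇒≥ λ 0<Σ → case-positive (sum-positive σ 0<Σ))
        where
        case-positive : ¬ ∃ (λ i → 0 < σ i)
        case-positive (i , 0<σ) = ℕ.<⇒≢ (ℕ.<-≤-trans (sgn-positive 0<σ) (term≤sum (sgn ∘ σ) i)) (sym #≡0)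
          where
          sgn-positive : ∀ {m} → 0 < m → 0 < sgn m
          sgn-positive {suc _} _ = ℕ.z<s

      private
        W : ℕ
        W = sum (λ c → T c ∸ 1)

      -- The maximum of f is written `suc α`, so that `high` and `full` are positive exactly where f
      -- and σ reach it.
      tall : ∀ α → 0 < α → (∃ λ i → f i ≡ suc α) → (∀ i → f i ≤ suc α) → sum f + sum g ≤ sum T + (1 ⊔ 3 * sum σ)
      tall α 0<α (i₀ , fi₀) f≤ = subst (λ t → sum f + sum g ≤ t + (1 ⊔ 3 * sum σ)) (sym ΣT)
        (total-tall (sum f) (sum g) (# f) (# g) (# high) (# T) W (sum σ) (# σ) (# full) α
          columns (classes high full (i₀ , 0<high) cover) layers #f≤#g (slack (sum σ) (# σ) #≡0⇒sum≡0))
        where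
        high full : Fin q → ℕ
        high i = f i ∸ α
        full t = σ t ∸ α
        0<high : 0 < high i₀
        0<high = subst (λ m → 0 < m ∸ α) (sym fi₀) (subst (0 <_) (sym (ℕ.m+n∸n≡m 1 α)) ℕ.z<s)
        0<fi₀ : 0 < f i₀
        0<fi₀ = subst (0 <_) (sym fi₀) ℕ.z<s
        cover : ∀ i j → 0 < high i → 0 < g j → 0 < full (i ⊕ ⊖ j) ⊎ 0 < T (i ⊕ j)
        cover i j 0<h 0<g with α ℕ.<? σ (i ⊕ ⊖ j)
        ... | yes α<σ = inj₁ (ℕ.m<n⇒0<n∸m α<σ)
        ... | no α≮σ = inj₂ (ℕ.+-cancelʳ-< α 0 (T (i ⊕ j)) (begin-strict
          α                              <⟨ ℕ.m∸n≢0⇒n<m (ℕ.>⇒≢ 0<h) ⟩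
          f i                            ≤⟨ boundˡ i j 0<g ⟩
          T (i ⊕ j) + σ (i ⊕ ⊖ j)        ≤⟨ ℕ.+-monoʳ-≤ (T (i ⊕ j)) (ℕ.≮⇒≥ α≮σ) ⟩
          T (i ⊕ j) + α                  ∎))
          where open ℕ.≤-Reasoning
        -- Each non-empty class holds at most α elements, and one more only if it attains the
        -- maximum.
        layers : sum f ≤ α * # f + # high
        layers = begin
          sum f                                          ≤⟨ sum-mono (λ i → layer (f i) (f≤ i)) ⟩
          sum (λ i → α * sgn (f i) + sgn (high i))       ≡⟨ ∑-distrib-+ (λ i → α * sgn (f i)) (sgn ∘ high) ⟩
          sum (λ i → α * sgn (f i)) + # high             ≡⟨ cong (_+ # high) (*-distribˡ-sum α (sgn ∘ f)) ⟨
          α * # f + # high                               ∎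
          where
          open ℕ.≤-Reasoning
          layer : ∀ m → m ≤ suc α → m ≤ α * sgn m + sgn (m ∸ α)
          layer zero    _ = z≤n
          layer (suc m) m≤ with suc m ℕ.≤? α
          ... | yes m≤α = ℕ.≤-trans m≤α (ℕ.≤-trans (ℕ.≤-reflexive (sym (ℕ.*-identityʳ α))) (ℕ.m≤m+n _ _))
          ... | no m≰α rewrite ℕ.≤-antisym m≤ (ℕ.≰⇒> m≰α) | ℕ.m+n∸n≡m 1 α =
            ℕ.≤-reflexive (trans (ℕ.+-comm 1 α) (cong (_+ 1) (sym (ℕ.*-identityʳ α))))
        -- Both j ↦ i₀ + j and j ↦ i₀ - j permute the classes, so summing `column-tall` over j
        -- yields totals independent of i₀.
        columns : suc α * # g + sum g + 2 * # full + # σ ≤ W + 2 * # g + 3 * sum σ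
        columns = begin
          suc α * # g + sum g + 2 * # full + # σ
            ≡⟨ cong₂ (λ x y → suc α * # g + sum g + 2 * x + y) (sum-reflect (sgn ∘ full) i₀) (sum-reflect (sgn ∘ σ) i₀) ⟨
          suc α * # g + sum g + 2 * sum (sgn ∘ full ∘ r) + sum (sgn ∘ σ ∘ r)
            ≡⟨ cong₂ (λ x y → x + sum g + y + sum (sgn ∘ σ ∘ r)) (*-distribˡ-sum (suc α) (sgn ∘ g)) (*-distribˡ-sum 2 (sgn ∘ full ∘ r)) ⟩
          sum (λ j → suc α * sgn (g j)) + sum g + sum (λ j → 2 * sgn (full (r j))) + sum (sgn ∘ σ ∘ r)
            ≡⟨ cong (λ x → x + sum (λ j → 2 * sgn (full (r j))) + sum (sgn ∘ σ ∘ r)) (∑-distrib-+ (λ j → suc α * sgn (g j)) g) ⟨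
          sum (λ j → suc α * sgn (g j) + g j) + sum (λ j → 2 * sgn (full (r j))) + sum (sgn ∘ σ ∘ r)
            ≡⟨ cong (_+ sum (sgn ∘ σ ∘ r)) (∑-distrib-+ (λ j → suc α * sgn (g j) + g j) (λ j → 2 * sgn (full (r j)))) ⟨
          sum (λ j → suc α * sgn (g j) + g j + 2 * sgn (full (r j))) + sum (sgn ∘ σ ∘ r)
            ≡⟨ ∑-distrib-+ (λ j → suc α * sgn (g j) + g j + 2 * sgn (full (r j))) (sgn ∘ σ ∘ r) ⟨
          sum (λ j → suc α * sgn (g j) + g j + 2 * sgn (full (r j)) + sgn (σ (r j)))
            ≤⟨ sum-mono (λ j → column-tall α (g j) (T (i₀ ⊕ j)) (σ (r j)) 0<α
                 (λ 0<g → subst (λ m → m + g j ≤ T (i₀ ⊕ j) + (1 ⊔ 3 * σ (r j))) fi₀ (bound′ i₀ j 0<fi₀ 0<g))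
                 (λ 0<g → boundʳ i₀ j 0<fi₀)) ⟩
          sum (λ j → (T (i₀ ⊕ j) ∸ 1) + 2 * sgn (g j) + 3 * σ (r j))
            ≡⟨ ∑-distrib-+ (λ j → (T (i₀ ⊕ j) ∸ 1) + 2 * sgn (g j)) (λ j → 3 * σ (r j)) ⟩
          sum (λ j → (T (i₀ ⊕ j) ∸ 1) + 2 * sgn (g j)) + sum (λ j → 3 * σ (r j))
            ≡⟨ cong (_+ sum (λ j → 3 * σ (r j))) (∑-distrib-+ (λ j → T (i₀ ⊕ j) ∸ 1) (λ j → 2 * sgn (g j))) ⟩
          sum (λ j → T (i₀ ⊕ j) ∸ 1) + sum (λ j → 2 * sgn (g j)) + sum (λ j → 3 * σ (r j))
            ≡⟨ cong₂ _+_ (cong₂ _+_ (sum-translate (λ c → T c ∸ 1) i₀) (sym (*-distribˡ-sum 2 (sgn ∘ g))))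
                 (trans (sym (*-distribˡ-sum 3 (σ ∘ r))) (cong (3 *_) (sum-reflect σ i₀))) ⟩
          W + 2 * # g + 3 * sum σ ∎
          where
          open ℕ.≤-Reasoning
          r : Fin q → Fin q
          r j = i₀ ⊕ ⊖ j

      module _ (f≤1 : ∀ i → f i ≤ 1) where

        flat-left : Fin q → Fin q → ℕ
        flat-left i j = sgn (g j) + g j

        flat-right : Fin q → Fin q → ℕ
        flat-right i j = (T (i ⊕ j) ∸ 1) + 2 * sgn (g j) + σ (i ⊕ ⊖ j)

        Σleft : ∀ i → sum (flat-left i) ≡ # g + sum g
        Σleft i = ∑-distrib-+ (sgn ∘ g) g

        Σright : ∀ i → sum (flat-right i) ≡ W + 2 * # g + sum σ
        Σright i = trans (∑-distrib-+ (λ j → (T (i ⊕ j) ∸ 1) + 2 * sgn (g j)) (λ j → σ (i ⊕ ⊖ j)))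
          (cong₂ _+_
            (trans (∑-distrib-+ (λ j → T (i ⊕ j) ∸ 1) (λ j → 2 * sgn (g j)))
              (cong₂ _+_ (sum-translate (λ c → T c ∸ 1) i) (sym (*-distribˡ-sum 2 (sgn ∘ g)))))
            (sum-reflect σ i))

        left≤right : ∀ i → 0 < f i → ∀ j → flat-left i j ≤ flat-right i j
        left≤right i 0<f j = column-flat (g j) (T (i ⊕ j)) (σ (i ⊕ ⊖ j)) (λ _ → boundʳ i j 0<f)

        Σf≤#f : sum f ≤ # f
        Σf≤#f = sum-mono λ i → m≤sgn (f≤1 i)
          where
          m≤sgn : ∀ {m} → m ≤ 1 → m ≤ sgn m
          m≤sgn {zero}  _  = z≤n
          m≤sgn {suc m} le = le

        -- The fibrewise bounds `boundˡ` and `boundʳ` suffice here. All depends on whether some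
        -- fibre of B can be hidden by a fibre of S, that is, whether g j ≤ σ (i - j) for some
        -- occupied classes i and j.
        flat : sum f + sum g ≤ sum T + (1 ⊔ 3 * sum σ)
        flat with Fin.any? (λ i → Fin.any? (λ j →
          (0 ℕ.<? f i) ×-dec (0 ℕ.<? g j) ×-dec (g j ℕ.≤? σ (i ⊕ ⊖ j))))
        -- Every class of σ must be excepted, at a cost of 1 + 2 (number of classes) + |S|. The
        -- strict column at j returns 1, and the rest is at most 3|S|.
        ... | yes (i , j , 0<f , 0<g , g≤σ) = subst (λ t → sum f + sum g ≤ t + (1 ⊔ 3 * sum σ)) (sym ΣT)
          (total-flat (sum f) (sum g) (# f) (# g) (# T) W (sum σ) (# σ) 1
            (subst₂ _≤_ (trans (cong suc (Σleft i)) (ℕ.+-comm 1 (# g + sum g))) (Σright i)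
              (sum-mono-< j (left≤right i 0<f) (column-flat-< (g j) (T (i ⊕ j)) (σ (i ⊕ ⊖ j)) 0<g g≤σ)))
            (classes f σ (i , 0<f) cover) Σf≤#f
            (s≤s (begin
              2 * # σ + sum σ      ≤⟨ ℕ.+-monoˡ-≤ (sum σ) (ℕ.*-monoʳ-≤ 2 (sum-mono (sgn≤ ∘ σ))) ⟩
              2 * sum σ + sum σ    ≡⟨ ℕ.+-comm (2 * sum σ) (sum σ) ⟩
              3 * sum σ            ≤⟨ ℕ.m≤n⊔m 1 (3 * sum σ) ⟩
              1 ⊔ 3 * sum σ        ∎)))
          where
          open ℕ.≤-Reasoning
          cover : ∀ i j → 0 < f i → 0 < g j → 0 < σ (i ⊕ ⊖ j) ⊎ 0 < T (i ⊕ j)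
          cover i j 0<f 0<g with σ (i ⊕ ⊖ j) in eq
          ... | suc _ = inj₁ ℕ.z<s
          ... | zero  = inj₂ (subst (0 <_) (trans (cong (T (i ⊕ j) +_) eq) (ℕ.+-identityʳ _)) (ℕ.<-≤-trans 0<f (boundˡ i j 0<g)))
        -- No fibre is hidden, so C meets every sum of occupied classes. The ℤ/q theorem applies
        -- with no exceptions and loses only 1, while the columns lose |S|.
        ... | no none = subst (λ t → sum f + sum g ≤ t + (1 ⊔ 3 * sum σ)) (sym ΣT)
          (total-flat (sum f) (sum g) (# f) (# g) (# T) W (sum σ) 0 0
            (subst₂ _≤_ (trans (Σleft i₀) (sym (ℕ.+-identityʳ _))) (Σright i₀) (sum-mono (left≤right i₀ 0<fi₀)))
            (subst (λ s → # f + # g ≤ # T + suc (2 * s)) (sum-replicate-zero q)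
              (classes f (λ _ → 0) (i₀ , 0<fi₀) cover))
            Σf≤#f (suc≤1⊔3* (sum σ)))
          where
          i₀ : Fin q
          i₀ = proj₁ (sum-positive f 0<Σf)
          0<fi₀ : 0 < f i₀
          0<fi₀ = proj₂ (sum-positive f 0<Σf)
          cover : ∀ i j → 0 < f i → 0 < g j → 0 < 0 ⊎ 0 < T (i ⊕ j)
          cover i j 0<f 0<g = inj₂ (ℕ.+-cancelʳ-< (σ (i ⊕ ⊖ j)) 0 (T (i ⊕ j))
            (ℕ.<-≤-trans (ℕ.≰⇒> λ g≤σ → none (i , j , 0<f , 0<g , g≤σ)) (boundʳ i j 0<f)))

      narrow : sum f + sum g ≤ sum T + (1 ⊔ 3 * sum σ)
      narrow with maximum f (proj₁ (sum-positive f 0<Σf))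
      ... | i₀ , f≤ with f i₀ in eq
      ...   | zero        = contradiction (proj₂ (sum-positive f 0<Σf)) (ℕ.≤⇒≯ (f≤ _))
      ...   | suc zero    = flat f≤
      ...   | suc (suc α) = tall (suc α) ℕ.z<s (i₀ , eq) f≤

    fiber-sizes-bound : ∀ {p} → p ≤ q → ∀ {f g σ T} → FiberSizes p f g σ T → 0 < sum f → 0 < sum g →
      p ≤ sum T ⊎ sum f + sum g ≤ sum T + (1 ⊔ 3 * sum σ)
    fiber-sizes-bound {p} p≤q {f} {g} {σ} {T} sizes 0<Σf 0<Σg with p ℕ.≤? sum T | ℕ.≤-total (# f) (# g)
    ... | yes p≤ | _ = inj₁ p≤
    ... | no p≰  | inj₁ #f≤#g = inj₂ (narrow p≤q sizes 0<Σf 0<Σg #f≤#g p≰)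
    ... | no p≰  | inj₂ #g≤#f = inj₂ (subst₂ (λ x s → x ≤ sum T + (1 ⊔ 3 * s)) (ℕ.+-comm (sum g) (sum f)) (sum-negate σ)
      (narrow p≤q (FiberSizes-swap sizes) 0<Σg 0<Σf #g≤#f p≰))

open Counting

-- Fibres of a map to Fin q

fiber : ∀ {X : Set} {q} → (X → Fin q) → List X → Fin q → List X
fiber φ xs i = filter (λ x → φ x Fin.≟ i) xs

∈-fiber : ∀ {X : Set} {q} (φ : X → Fin q) {xs x i} → x ∈ xs → φ x ≡ i → x ∈ fiber φ xs i
∈-fiber φ {i = i} x∈ eq = ∈-filter⁺ (λ x → φ x Fin.≟ i) x∈ eq

fiber-∈ : ∀ {X : Set} {q} (φ : X → Fin q) {xs x i} → x ∈ fiber φ xs i → x ∈ xs × φ x ≡ i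
fiber-∈ φ {i = i} x∈ = ∈-filter⁻ (λ x → φ x Fin.≟ i) x∈

fiber-unique : ∀ {X : Set} {q} (φ : X → Fin q) {xs} i → Unique xs → Unique (fiber φ xs i)
fiber-unique φ i = Unique.filter⁺ (λ x → φ x Fin.≟ i)

sum-fibers : ∀ {X : Set} {q} (φ : X → Fin q) xs → sum (λ i → length (fiber φ xs i)) ≡ length xs
sum-fibers {q = q} φ []       = sum-replicate-zero q
sum-fibers {q = q} φ (x ∷ xs) = begin
  sum (λ i → length (fiber φ (x ∷ xs) i))               ≡⟨ sum-cong-≗ split ⟩
  sum (λ i → δ (φ x) i ℕ.+ length (fiber φ xs i))       ≡⟨ ∑-distrib-+ (δ (φ x)) (λ i → length (fiber φ xs i)) ⟩
  sum (δ (φ x)) ℕ.+ sum (λ i → length (fiber φ xs i))   ≡⟨ cong₂ ℕ._+_ (sum-δ (φ x)) (sum-fibers φ xs) ⟩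
  suc (length xs)                                       ∎
  where
  open ≡-Reasoning
  δ : ∀ {q} → Fin q → Fin q → ℕ
  δ i j = if does (i Fin.≟ j) then 1 else 0
  sum-δ : ∀ {q} (i : Fin q) → sum (δ i) ≡ 1
  sum-δ {suc q} zero    = cong suc (sum-replicate-zero q)
  sum-δ {suc q} (suc i) = sum-δ i
  split : ∀ i → length (fiber φ (x ∷ xs) i) ≡ δ (φ x) i ℕ.+ length (fiber φ xs i)
  split i with does (φ x Fin.≟ i)
  ... | true  = refl
  ... | false = refl

-- Subgroups of G and the inductive step along a chain

module GroupBounds {n : ℕ} (G : FiniteAbelianGroup n) where
  open FiniteAbelianGroup G

  𝔾 : AbelianGroup 0ℓ 0ℓ
  𝔾 = record
    { Carrier = Fin n ; _≈_ = _≡_ ; _∙_ = _+_ ; ε = 0# ; _⁻¹ = -_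
    ; isAbelianGroup = record
      { isGroup = record
        { isMonoid = record
          { isSemigroup = record
            { isMagma = record { isEquivalence = isEquivalence ; ∙-cong = cong₂ _+_ }
            ; assoc = +-assoc
            }
          ; identity = +-identityˡ , λ x → trans (+-comm x 0#) (+-identityˡ x)
          }
        ; inverse = +-inverseˡ , λ x → trans (+-comm x (- x)) (+-inverseˡ x)
        ; ⁻¹-cong = cong (λ x → - x)
        }
      ; comm = +-comm
      }
    }

  open AbelianGroup 𝔾 using (commutativeMonoid; monoid; commutativeSemigroup)
    renaming (identityʳ to +-identityʳ; inverseʳ to +-inverseʳ)
  open import Algebra.Properties.AbelianGroup 𝔾
  open import Algebra.Properties.CommutativeSemigroup commutativeSemigroup using (interchange)
  open import Algebra.Properties.Monoid.Mult monoid using (×-homo-+; ×-assocˡ; ×-homo-1) renaming (_×_ to _·_)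
  import Algebra.Properties.CommutativeMonoid.Sum commutativeMonoid as ΣG

  +-‿interchange : ∀ a b c d → (a + b) - (c + d) ≡ (a - c) + (b - d)
  +-‿interchange a b c d = trans (cong ((a + b) +_) (sym (⁻¹-∙-comm c d))) (interchange a b (- c) (- d))

  -‿interchange : ∀ a b c d → (a - b) - (c - d) ≡ (a - c) - (b - d)
  -‿interchange a b c d = trans (+-‿interchange a (- b) c (- d)) (cong ((a - c) +_) (⁻¹-∙-comm b (- d)))

  -‿cancelʳ : ∀ a b c → (a - c) - (b - c) ≡ a - b
  -‿cancelʳ a b c = begin
    (a - c) - (b - c)  ≡⟨ -‿interchange a c b c ⟩
    (a - b) - (c - c)  ≡⟨ cong (λ z → (a - b) - z) (+-inverseʳ c) ⟩
    (a - b) - 0#       ≡⟨ cong ((a - b) +_) ε⁻¹≈ε ⟩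
    (a - b) + 0#       ≡⟨ +-identityʳ (a - b) ⟩
    a - b              ∎
    where open ≡-Reasoning

  -‿cancelˡ : ∀ a b c → (c - a) - (c - b) ≡ b - a
  -‿cancelˡ a b c = begin
    (c - a) - (c - b)  ≡⟨ -‿interchange c a c b ⟩
    (c - c) - (a - b)  ≡⟨ cong (λ z′ → z′ - (a - b)) (+-inverseʳ c) ⟩
    0# - (a - b)       ≡⟨ +-identityˡ _ ⟩
    - (a - b)          ≡⟨ ⁻¹-anti-homo‿- a b ⟩
    b - a              ∎
    where open ≡-Reasoning

  -‿+-cancel : ∀ a b → (a - b) + b ≡ a
  -‿+-cancel a b = trans (+-assoc a (- b) b) (trans (cong (a +_) (+-inverseˡ b)) (+-identityʳ a))

  +-‿cancel : ∀ a b → (a + b) - b ≡ a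
  +-‿cancel a b = trans (+-assoc a b (- b)) (trans (cong (a +_) (+-inverseʳ b)) (+-identityʳ a))

  -- Translation by x permutes G, so the sum of all elements is unchanged by adding n · x.
  n·x≡0 : ∀ x → n · x ≡ 0#
  n·x≡0 x = identityˡ-unique (n · x) (ΣG.sum (λ i → i)) (begin
    n · x + ΣG.sum (λ i → i)                   ≡⟨ cong (_+ ΣG.sum (λ i → i)) (ΣG.sum-replicate n) ⟨
    ΣG.sum (λ (_ : Fin n) → x) + ΣG.sum (λ i → i) ≡⟨ ΣG.∑-distrib-+ {n} (λ _ → x) (λ i → i) ⟨
    ΣG.sum (λ i → x + i)                       ≡⟨ ΣG.sum-permute (λ i → i) (permutation (x +_) (λ z′ → z′ - x)
                                                   (λ y → trans (+-comm x (y - x)) (-‿+-cancel y x))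
                                                   (λ y → trans (cong (λ z′ → z′ - x) (+-comm x y)) (+-‿cancel y x))) ⟨
    ΣG.sum (λ i → i)                           ∎)
    where open ≡-Reasoning

  Cover : List (Fin n) → List (Fin n) → List (Fin n) → List (Fin n) → Set
  Cover A B S C = ∀ {a b} → a ∈ A → b ∈ B → a - b ∈ S ⊎ a + b ∈ C

  -- Fix one b: each a is recovered from a - b in S or from a + b in C.
  cover-boundˡ : ∀ {A B S C} → Cover A B S C → Unique A → 0 < length B → length A ≤ length C ℕ.+ length S
  cover-boundˡ {B = b ∷ _} cover uniq _ = length-≤-images (λ z′ → z′ - b) (_+ b) uniq λ {a} a∈ →
    case cover a∈ (here refl) of λ
      { (inj₁ ∈S) → inj₂ (a - b , ∈S , sym (-‿+-cancel a b))
      ; (inj₂ ∈C) → inj₁ (a + b , ∈C , sym (+-‿cancel a b)) }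

  cover-boundʳ : ∀ {A B S C} → Cover A B S C → Unique B → 0 < length A → length B ≤ length C ℕ.+ length S
  cover-boundʳ {A = a ∷ _} cover uniq _ = length-≤-images (λ z′ → z′ - a) (λ s → a - s) uniq λ {b} b∈ →
    case cover (here refl) b∈ of λ
      { (inj₁ ∈S) → inj₂ (a - b , ∈S , sym (begin
          a - (a - b)         ≡⟨ cong (a +_) (⁻¹-anti-homo‿- a b) ⟩
          a + (b - a)         ≡⟨ +-comm a (b - a) ⟩
          (b - a) + a         ≡⟨ -‿+-cancel b a ⟩
          b                   ∎))
      ; (inj₂ ∈C) → inj₁ (a + b , ∈C , sym (trans (cong (λ z′ → z′ - a) (+-comm a b)) (+-‿cancel b a))) }
    where open ≡-Reasoning

  record Subgroup : Set₁ where
    field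
      Member   : Fin n → Set
      member?  : ∀ x → Dec (Member x)
      0-closed : Member 0#
      +-closed : ∀ {x y} → Member x → Member y → Member (x + y)
      neg-closed : ∀ {x} → Member x → Member (- x)

    -‿closed : ∀ {x y} → Member x → Member y → Member (x - y)
    -‿closed x∈ y∈ = +-closed x∈ (neg-closed y∈)

    ·-closed : ∀ m {x} → Member x → Member (m · x)
    ·-closed zero    x∈ = 0-closed
    ·-closed (suc m) x∈ = +-closed x∈ (·-closed m x∈)

    coprime-closed : ∀ {k m x} → Coprime k m → Member (k · x) → Member (m · x) → Member x
    coprime-closed {k} {m} {x} coprime k∈ m∈ with coprime-Bézout coprime
    ... | Bézout.+- u v eq = subst Member (trans (cong (λ z′ → z′ - v · (m · x)) (begin
        u · (k · x)        ≡⟨ ×-assocˡ x u k ⟩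
        (u ℕ.* k) · x      ≡⟨ cong (_· x) eq ⟨
        x + (v ℕ.* m) · x  ≡⟨ cong (x +_) (×-assocˡ x v m) ⟨
        x + v · (m · x)    ∎)) (+-‿cancel x _)) (-‿closed (·-closed u k∈) (·-closed v m∈))
      where open ≡-Reasoning
    ... | Bézout.-+ u v eq = subst Member (trans (cong (λ z′ → z′ - u · (k · x)) (begin
        v · (m · x)        ≡⟨ ×-assocˡ x v m ⟩
        (v ℕ.* m) · x      ≡⟨ cong (_· x) eq ⟨
        x + (u ℕ.* k) · x  ≡⟨ cong (x +_) (×-assocˡ x u k) ⟨
        x + u · (k · x)    ∎)) (+-‿cancel x _)) (-‿closed (·-closed v m∈) (·-closed u k∈))
      where open ≡-Reasoning

  InOneCoset : Subgroup → List (Fin n) → Set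
  InOneCoset H xs = ∀ {x y} → x ∈ xs → y ∈ xs → Subgroup.Member H (x - y)

  -- A and B may lie in different cosets of H, as fibres of larger sets do, and S and C are
  -- restricted only by the covering condition.
  SumsetBound : ℕ → Subgroup → Set
  SumsetBound p H = ∀ {A B S C} → Unique A → Unique B → 0 < length A → 0 < length B →
    InOneCoset H A → InOneCoset H B → Cover A B S C →
    p ≤ length C ⊎ length A ℕ.+ length B ≤ length C ℕ.+ (1 ⊔ 3 ℕ.* length S)

  trivialSubgroup : Subgroup
  trivialSubgroup = record
    { Member = _≡ 0#
    ; member? = λ x → x Fin.≟ 0#
    ; 0-closed = refl
    ; +-closed = λ { refl refl → +-identityˡ 0# }
    ; neg-closed = λ { refl → ε⁻¹≈ε }
    }

  -- Cosets of the trivial subgroup are points, so |A| + |B| = 2. Either C is non-empty and the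
  -- maximum supplies the other 1, or S is non-empty and 3|S| suffices alone.
  trivial-bound : ∀ p → SumsetBound p trivialSubgroup
  trivial-bound p {a ∷ a′ ∷ _} ((a≢a′ ∷ _) ∷ _) _ _ _ A⊆ _ _ =
    contradiction (x∙y⁻¹≈ε⇒x≈y a a′ (A⊆ (here refl) (there (here refl)))) a≢a′
  trivial-bound p {_ ∷ []} {b ∷ b′ ∷ _} _ ((b≢b′ ∷ _) ∷ _) _ _ _ B⊆ _ =
    contradiction (x∙y⁻¹≈ε⇒x≈y b b′ (B⊆ (here refl) (there (here refl)))) b≢b′
  trivial-bound p {a ∷ []} {b ∷ []} {S} {C} _ _ _ _ _ _ cover with cover (here refl) (here refl)
  ... | inj₂ ∈C = inj₂ (ℕ.+-mono-≤ (∈-length ∈C) (ℕ.m≤m⊔n 1 (3 ℕ.* length S)))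
  ... | inj₁ ∈S = inj₂ (ℕ.≤-trans (ℕ.≤-trans (ℕ.≤-trans (ℕ.n≤1+n 2) (ℕ.*-monoʳ-≤ 3 (∈-length ∈S)))
    (ℕ.m≤n⊔m 1 (3 ℕ.* length S))) (ℕ.m≤n+m _ (length C)))

  module Extension (H : Subgroup) (q : ℕ) .{{_ : NonZero q}} (q-prime : Prime q)
    (y : Fin n) (y∉H : ¬ Subgroup.Member H y) (qy∈H : Subgroup.Member H (q · y)) where
    open Subgroup H
    open Modular q

    Coset : Fin n → ℕ → Set
    Coset z m = Member (z - m · y)

    Coset-+ : ∀ {z w} k m → Coset z k → Coset w m → Coset (z + w) (k ℕ.+ m)
    Coset-+ {z} {w} k m z∈ w∈ = subst Member (trans (sym (+-‿interchange z w (k · y) (m · y)))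
      (cong (λ t → (z + w) - t) (sym (×-homo-+ y k m)))) (+-closed z∈ w∈)

    -- m · y and (m % q) · y differ by a multiple of q · y, which lies in H.
    Coset-% : ∀ {z} m → Coset z m → Coset z (m % q)
    Coset-% {z} m z∈ = subst Member (begin
      (z - m · y) + (m / q) · (q · y)
        ≡⟨ cong₂ (λ s t → (z - s) + t) (trans (cong (_· y) (m≡m%n+[m/n]*n m q)) (×-homo-+ y (m % q) (m / q ℕ.* q))) (×-assocˡ y (m / q) q) ⟩
      (z - (r + t)) + t          ≡⟨ cong (λ s → (z + s) + t) (⁻¹-∙-comm r t) ⟨
      (z + (- r - t)) + t        ≡⟨ cong (_+ t) (+-assoc z (- r) (- t)) ⟨
      ((z - r) - t) + t          ≡⟨ -‿+-cancel (z - r) t ⟩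
      z - r                      ∎) (+-closed z∈ (·-closed (m / q) qy∈H))
      where
      open ≡-Reasoning
      r t : Fin n
      r = (m % q) · y
      t = (m / q ℕ.* q) · y

    -- A common element would put (m - k) · y in H; as m - k is coprime to q and q · y is in H, y
    -- itself would be in H.
    Coset-≮ : ∀ {z k m} → k < m → m < q → Coset z k → ¬ Coset z m
    Coset-≮ {z} {k} {m} k<m m<q z∈k z∈m = y∉H (coprime-closed
      (prime⇒coprime q-prime {{ℕ.>-nonZero (ℕ.m<n⇒0<n∸m k<m)}} (ℕ.≤-<-trans (ℕ.m∸n≤m m k) m<q))
      qy∈H (subst Member (begin
        (z - k · y) - (z - m · y)            ≡⟨ -‿cancelˡ (k · y) (m · y) z ⟩
        m · y - k · y                        ≡⟨ cong (λ j → j · y - k · y) (ℕ.m∸n+n≡m (ℕ.<⇒≤ k<m)) ⟨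
        (m ℕ.∸ k ℕ.+ k) · y - k · y          ≡⟨ cong (λ z′ → z′ - k · y) (×-homo-+ y (m ℕ.∸ k) k) ⟩
        ((m ℕ.∸ k) · y + k · y) - k · y      ≡⟨ +-‿cancel _ _ ⟩
        (m ℕ.∸ k) · y                        ∎) (-‿closed z∈k z∈m)))
      where open ≡-Reasoning

    Extended : Fin n → Set
    Extended z = ∃ λ (i : Fin q) → Coset z (toℕ i)

    extended? : ∀ z → Dec (Extended z)
    extended? z = Fin.any? λ i → member? (z - toℕ i · y)

    coset⇒extended : ∀ {z} m → Coset z m → Extended z
    coset⇒extended {z} m z∈ = [ m ] , subst (Coset z) (sym (toℕ-[] m)) (Coset-% m z∈)

    Coset-neg : ∀ {z} (i : Fin q) → Coset z (toℕ i) → Coset (- z) (q ℕ.∸ toℕ i)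
    Coset-neg {z} i z∈ = subst Member (begin
      - (z - s) - q · y              ≡⟨ cong₂ _-_ (⁻¹-anti-homo‿- z s) (trans
                                          (cong (_· y) (sym (ℕ.m+[n∸m]≡n (ℕ.<⇒≤ (Fin.toℕ<n i))))) (×-homo-+ y (toℕ i) (q ℕ.∸ toℕ i))) ⟩
      (s - z) - (s + t)              ≡⟨ +-‿interchange s (- z) s t ⟩
      (s - s) + (- z - t)            ≡⟨ cong (_+ (- z - t)) (+-inverseʳ s) ⟩
      0# + (- z - t)                 ≡⟨ +-identityˡ _ ⟩
      - z - t                        ∎) (-‿closed (neg-closed z∈) qy∈H)
      where
      open ≡-Reasoning
      s t : Fin n
      s = toℕ i · y
      t = (q ℕ.∸ toℕ i) · y

    extension : Subgroup
    extension = record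
      { Member = Extended
      ; member? = extended?
      ; 0-closed = coset⇒extended 0 (-‿closed 0-closed 0-closed)
      ; +-closed = λ (i , z∈) (j , w∈) → coset⇒extended (toℕ i ℕ.+ toℕ j) (Coset-+ (toℕ i) (toℕ j) z∈ w∈)
      ; neg-closed = λ (i , z∈) → coset⇒extended (q ℕ.∸ toℕ i) (Coset-neg i z∈)
      }

    ⊆extension : ∀ {z} → Member z → Extended z
    ⊆extension z∈ = coset⇒extended 0 (-‿closed z∈ 0-closed)

    y∈extension : Extended y
    y∈extension = coset⇒extended 1 (subst Member (sym (trans (cong (λ t → y - t) (×-homo-1 y)) (+-inverseʳ y))) 0-closed)

    -- Junk value 0 outside the extension.
    coordinate : Fin n → Fin q
    coordinate z with extended? z
    ... | yes (i , _) = i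
    ... | no _        = [ 0 ]

    coordinate-coset : ∀ {z} → Extended z → Coset z (toℕ (coordinate z))
    coordinate-coset {z} z∈ with extended? z
    ... | yes (i , z∈i) = z∈i
    ... | no z∉         = contradiction z∈ z∉

    coordinate-unique : ∀ {z} m → Coset z m → coordinate z ≡ [ m ]
    coordinate-unique {z} m z∈m = Fin.toℕ-injective (case ℕ.<-cmp (toℕ i) (toℕ [ m ]) of λ
      { (tri< lt _ _) → contradiction z∈[m] (Coset-≮ lt (Fin.toℕ<n [ m ]) z∈i)
      ; (tri≈ _ eq _) → eq
      ; (tri> _ _ gt) → contradiction z∈i (Coset-≮ gt (Fin.toℕ<n i) z∈[m]) })
      where
      i : Fin q
      i = coordinate z
      z∈[m] : Coset z (toℕ [ m ])
      z∈[m] = proj₂ (coset⇒extended m z∈m)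
      z∈i : Coset z (toℕ i)
      z∈i = coordinate-coset (coset⇒extended m z∈m)

    coordinate-+ : ∀ {z w} → Extended z → Extended w → coordinate (z + w) ≡ coordinate z ⊕ coordinate w
    coordinate-+ {z} {w} z∈ w∈ = coordinate-unique _ (Coset-+ (toℕ (coordinate z)) (toℕ (coordinate w)) (coordinate-coset z∈) (coordinate-coset w∈))

    coordinate-neg : ∀ {z} → Extended z → coordinate (- z) ≡ ⊖ coordinate z
    coordinate-neg {z} z∈ = coordinate-unique _ (Coset-neg (coordinate z) (coordinate-coset z∈))

    same-coordinate : ∀ {z w} → Extended z → Extended w → coordinate z ≡ coordinate w → Member (z - w)
    same-coordinate {z} {w} z∈ w∈ eq = subst Member (-‿cancelʳ z w (toℕ (coordinate w) · y))
      (-‿closed (subst (Coset z ∘ toℕ) eq (coordinate-coset z∈)) (coordinate-coset w∈))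

    -- Coordinates measured from a₀ and b₀ are additive, so the fibres of A over i and of B over j
    -- are covered by those of S over i - j and of C over i + j. These fibres of A and B lie in
    -- cosets of H, where `H-bound` applies.
    extension-bound : ∀ {p} → 2 < q → p ≤ q → SumsetBound p H → SumsetBound p extension
    extension-bound {p} 2<q p≤q H-bound {A@(a₀ ∷ _)} {B@(b₀ ∷ _)} {S} {C} uA uB 0<A 0<B A⊆ B⊆ cover =
      subst₂ _⊎_ (cong (p ≤_) ΣC)
        (cong₂ _≤_ (cong₂ ℕ._+_ (sum-fibers φA A) (sum-fibers φB B))
          (cong₂ (λ c s → c ℕ.+ (1 ⊔ 3 ℕ.* s)) ΣC (sum-fibers φS S)))
        (fiber-sizes-bound p≤q sizes
          (subst (0 <_) (sym (sum-fibers φA A)) 0<A) (subst (0 <_) (sym (sum-fibers φB B)) 0<B))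
      where
      open FiberSizes q q-prime 2<q
      φA φB φS φC : Fin n → Fin q
      φA a = coordinate (a - a₀)
      φB b = coordinate (b - b₀)
      -- S and C may contain elements outside the relevant cosets. They land in the fibre over 0,
      -- which keeps the covering intact and the fibre sizes adding up to the full lengths.
      φS s = coordinate (s - (a₀ - b₀))
      φC c = coordinate (c - (a₀ + b₀))
      ΣC : sum (λ c → length (fiber φC C c)) ≡ length C
      ΣC = sum-fibers φC C
      a-a₀∈ : ∀ {a} → a ∈ A → Extended (a - a₀)
      a-a₀∈ a∈ = A⊆ a∈ (here refl)
      b-b₀∈ : ∀ {b} → b ∈ B → Extended (b - b₀)
      b-b₀∈ b∈ = B⊆ b∈ (here refl)
      φS-difference : ∀ {a b} → a ∈ A → b ∈ B → φS (a - b) ≡ φA a ⊕ ⊖ φB b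
      φS-difference {a} {b} a∈ b∈ = trans (cong coordinate (-‿interchange a b a₀ b₀))
        (trans (coordinate-+ (a-a₀∈ a∈) (Subgroup.neg-closed extension (b-b₀∈ b∈)))
          (cong (φA a ⊕_) (coordinate-neg (b-b₀∈ b∈))))
      φC-sum : ∀ {a b} → a ∈ A → b ∈ B → φC (a + b) ≡ φA a ⊕ φB b
      φC-sum {a} {b} a∈ b∈ = trans (cong coordinate (+-‿interchange a b a₀ b₀)) (coordinate-+ (a-a₀∈ a∈) (b-b₀∈ b∈))
      fiber-cover : ∀ i j → Cover (fiber φA A i) (fiber φB B j) (fiber φS S (i ⊕ ⊖ j)) (fiber φC C (i ⊕ j))
      fiber-cover i j a∈ b∈ with fiber-∈ φA a∈ | fiber-∈ φB b∈
      ... | a∈A , refl | b∈B , refl = Sum.map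
        (λ ∈S → ∈-fiber φS ∈S (φS-difference a∈A b∈B)) (λ ∈C → ∈-fiber φC ∈C (φC-sum a∈A b∈B)) (cover a∈A b∈B)
      A-coset : ∀ i → InOneCoset H (fiber φA A i)
      A-coset i {a} {a′} a∈ a′∈ with fiber-∈ φA a∈ | fiber-∈ φA a′∈
      ... | a∈A , eq | a′∈A , eq′ = subst Member (-‿cancelʳ a a′ a₀)
        (same-coordinate (a-a₀∈ a∈A) (a-a₀∈ a′∈A) (trans eq (sym eq′)))
      B-coset : ∀ j → InOneCoset H (fiber φB B j)
      B-coset j {b} {b′} b∈ b′∈ with fiber-∈ φB b∈ | fiber-∈ φB b′∈
      ... | b∈B , eq | b′∈B , eq′ = subst Member (-‿cancelʳ b b′ b₀)
        (same-coordinate (b-b₀∈ b∈B) (b-b₀∈ b′∈B) (trans eq (sym eq′)))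
      sizes : FiberSizes p (λ i → length (fiber φA A i)) (λ j → length (fiber φB B j))
        (λ t → length (fiber φS S t)) (λ c → length (fiber φC C c))
      sizes = record
        { boundˡ = λ i j 0<g → cover-boundˡ (fiber-cover i j) (fiber-unique φA i uA) 0<g
        ; boundʳ = λ i j 0<f → cover-boundʳ (fiber-cover i j) (fiber-unique φB j uB) 0<f
        ; bound = λ i j 0<f 0<g → H-bound (fiber-unique φA i uA) (fiber-unique φB j uB) 0<f 0<g
            (A-coset i) (B-coset j) (fiber-cover i j)
        }

  _⊆ˢ_ : Subgroup → Subgroup → Set
  H ⊆ˢ K = ∀ {z} → Subgroup.Member H z → Subgroup.Member K z

  -- Multiplying x by the primes of `qs` in turn leads into H. Going back along these multiples,
  -- each either lies in the current subgroup already or, as its q-th multiple does, generates an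
  -- extension of prime index q.
  adjoin : ∀ {p} → 2 < p → ∀ x qs → All Prime qs → All (p ≤_) qs → (H : Subgroup) → SumsetBound p H →
    Subgroup.Member H (product qs · x) → ∃ λ K → SumsetBound p K × H ⊆ˢ K × Subgroup.Member K x
  adjoin 2<p x [] _ _ H bound x∈H = H , bound , (λ z∈ → z∈) , subst (Subgroup.Member H) (×-homo-1 x) x∈H
  adjoin 2<p x (q ∷ qs) (q-prime ∷ primes) (p≤q ∷ p≤qs) H bound qx∈H with Subgroup.member? H (product qs · x)
  ... | yes y∈H = adjoin 2<p x qs primes p≤qs H bound y∈H
  ... | no y∉H with adjoin 2<p x qs primes p≤qs extension
                     (extension-bound (ℕ.<-≤-trans 2<p p≤q) p≤q bound) y∈extension
    where
    instance _ = prime⇒nonZero q-prime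
    open Extension H q q-prime (product qs · x) y∉H
      (subst (Subgroup.Member H) (sym (×-assocˡ x q (product qs))) qx∈H)
  ...   | K , K-bound , ext⊆K , x∈K = K , K-bound , (λ z∈ → ext⊆K (⊆extension z∈)) , x∈K
    where
    instance _ = prime⇒nonZero q-prime
    open Extension H q q-prime (product qs · x) y∉H
      (subst (Subgroup.Member H) (sym (×-assocˡ x q (product qs))) qx∈H)

  exhaust : ∀ {p} → 2 < p → ∀ qs → All Prime qs → All (p ≤_) qs → product qs ≡ n →
    ∀ xs → ∃ λ K → SumsetBound p K × (∀ {x} → x ∈ xs → Subgroup.Member K x)
  exhaust {p} 2<p qs primes p≤qs eq [] = trivialSubgroup , trivial-bound p , λ ()
  exhaust 2<p qs primes p≤qs eq (x ∷ xs) with exhaust 2<p qs primes p≤qs eq xs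
  ... | H , H-bound , xs⊆H with adjoin 2<p x qs primes p≤qs H H-bound
        (subst (Subgroup.Member H) (sym (trans (cong (_· x) eq) (n·x≡0 x))) (Subgroup.0-closed H))
  ...   | K , K-bound , H⊆K , x∈K = K , K-bound , λ { (here refl) → x∈K ; (there z∈) → H⊆K (xs⊆H z∈) }

  cover-size-bound : ∀ {p} → 2 < p → ∀ qs → All Prime qs → All (p ≤_) qs → product qs ≡ n →
    ∀ {A B S C} → Unique A → Unique B → 0 < length A → 0 < length B → Cover A B S C →
    p ≤ length C ⊎ length A ℕ.+ length B ≤ length C ℕ.+ (1 ⊔ 3 ℕ.* length S)
  cover-size-bound 2<p qs primes p≤qs eq uA uB 0<A 0<B cover with exhaust 2<p qs primes p≤qs eq (allFin n)
  ... | K , K-bound , all∈K = K-bound uA uB 0<A 0<B (λ _ _ → all∈K (∈-allFin _)) (λ _ _ → all∈K (∈-allFin _)) cover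

-- From lists back to subsets, and the final assembly

elements : ∀ {n} → Subset n → List (Fin n)
elements {n} A = filter (_∈? A) (allFin n)

∈-elements : ∀ {n} {A : Subset n} {x} → x Subset.∈ A → x ∈ elements A
∈-elements {A = A} x∈ = ∈-filter⁺ (_∈? A) (∈-allFin _) x∈

elements-∈ : ∀ {n} {A : Subset n} {x} → x ∈ elements A → x Subset.∈ A
elements-∈ {n} {A} x∈ = proj₂ (∈-filter⁻ (_∈? A) {xs = allFin n} x∈)

elements-unique : ∀ {n} (A : Subset n) → Unique (elements A)
elements-unique {n} A = Unique.filter⁺ (_∈? A) (Unique.allFin⁺ n)

length-elements : ∀ {n} (A : Subset n) → length (elements A) ≡ ∣ A ∣
length-elements A = go A (λ i → i) A (λ i → refl)
  where
  -- A′ is the part of A seen along e. The induction shortens e and A′ while the membership test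
  -- stays that of the original A.
  go : ∀ {m n} (A : Subset n) (e : Fin m → Fin n) (A′ : Subset m) → (∀ i → does (e i ∈? A) ≡ does (i ∈? A′)) →
    length (filter (_∈? A) (tabulate e)) ≡ ∣ A′ ∣
  go A e []            same = refl
  go A e (true ∷ A′)   same with does (e zero ∈? A) | same zero
  ... | true | _ = cong suc (go A (e ∘ suc) A′ (same ∘ suc))
  go A e (false ∷ A′) same with does (e zero ∈? A) | same zero
  ... | false | _ = go A (e ∘ suc) A′ (same ∘ suc)

∈-restrictedSumset : ∀ {n} (G : FiniteAbelianGroup n) (let module G = FiniteAbelianGroup G) {A B S : Subset n} {a b} →
  a Subset.∈ A → b Subset.∈ B → a G.- b Subset.∉ S → a G.+ b Subset.∈ restrictedSumset G A B S
∈-restrictedSumset G {A} {B} {S} {a} {b} a∈ b∈ a-b∉ = lookup⇒[]= (a G.+ b) (restrictedSumset G A B S) (begin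
  lookup (restrictedSumset G A B S) (a G.+ b)  ≡⟨ lookup∘tabulate (λ c → ⌊ sum? c ⌋) (a G.+ b) ⟩
  ⌊ sum? (a G.+ b) ⌋                           ≡⟨ isYes≗does (sum? (a G.+ b)) ⟩
  does (sum? (a G.+ b))                        ≡⟨ dec-true (sum? (a G.+ b)) (a , b , a∈ , b∈ , refl , a-b∉) ⟩
  true                                         ∎)
  where
  open ≡-Reasoning
  module G = FiniteAbelianGroup G
  sum? : ∀ c → Dec (∃ λ a → ∃ λ b → a Subset.∈ A × b Subset.∈ B × a G.+ b ≡ c × a G.- b Subset.∉ S)
  sum? c = Fin.any? (λ a → Fin.any? (λ b →
    (a ∈? A) ×-dec (b ∈? B) ×-dec ((a G.+ b) Fin.≟ c) ×-dec ¬? ((a G.- b) ∈? S)))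

open import Data.Nat using (ℕ; _+_; _*_; _∸_; _≤_; _⊓_)
open import Data.Nat.Divisibility using (_∣_)
open import Data.Nat.Primality using (Prime)
open import Data.Fin.Subset using (Subset; ∣_∣; Nonempty)

truncated-bound : ∀ {a b s c} p → 0 < s → p ≤ c ⊎ a + b ≤ c + (1 ⊔ 3 * s) → ((a + b) ∸ 3 * s) ⊓ p ≤ c
truncated-bound p 0<s (inj₁ p≤c) = ℕ.≤-trans (ℕ.m⊓n≤n _ p) p≤c
truncated-bound {a} {b} {suc s} {c} p 0<s (inj₂ le) = ℕ.≤-trans (ℕ.m⊓n≤m _ p)
  (ℕ.m≤n+o⇒m∸n≤o (a + b) (3 * suc s) (ℕ.≤-trans le (ℕ.≤-reflexive (ℕ.+-comm c (3 * suc s)))))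

-- If c ≤ 1 then c ≤ s, so one of the two copies of c in (c + s) + (c + s) can be replaced by s.
small-bound : ∀ {a b s c} → 0 < s → a ≤ c + s → b ≤ c + s → 2 ≤ c ⊎ a + b ≤ c + (1 ⊔ 3 * s)
small-bound {a} {b} {s@(suc _)} {c} 0<s a≤ b≤ with 2 ℕ.≤? c
... | yes 2≤c = inj₁ 2≤c
... | no 2≰c = inj₂ (begin
  a + b              ≤⟨ ℕ.+-mono-≤ a≤ b≤ ⟩
  (c + s) + (c + s)  ≤⟨ ℕ.+-monoʳ-≤ (c + s) (ℕ.+-monoˡ-≤ s (ℕ.≤-trans (ℕ.≤-pred (ℕ.≰⇒> 2≰c)) 0<s)) ⟩
  (c + s) + (s + s)  ≡⟨ regroup c s ⟩
  c + 3 * s          ≤⟨ ℕ.+-monoʳ-≤ c (ℕ.m≤n⊔m 1 (3 * s)) ⟩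
  c + (1 ⊔ 3 * s)    ∎)
  where
  open ℕ.≤-Reasoning
  regroup : ∀ c s → (c + s) + (s + s) ≡ c + 3 * s
  regroup = solve-∀

theorem1p1 : ∀ {n} (G : FiniteAbelianGroup n) (A B S : Subset n) →
    Nonempty A → Nonempty B → Nonempty S →
    (p : ℕ) → Prime p → p ∣ n → (∀ q → Prime q → q ∣ n → p ≤ q) →
    ((∣ A ∣ + ∣ B ∣) ∸ 3 * ∣ S ∣) ⊓ p ≤ ∣ restrictedSumset G A B S ∣
theorem1p1 {n} G A B S (a , a∈A) (b , b∈B) (s , s∈S) p p-prime p∣n p-least =
  truncated-bound {∣ A ∣} {∣ B ∣} {∣ S ∣} p (positive S s∈S)
    (subst₂ (λ x y → p ≤ x ⊎ y ≤ x + (1 ⊔ 3 * ∣ S ∣)) (length-elements C)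
      (cong₂ _+_ (length-elements A) (length-elements B))
      (subst (λ s → p ≤ length (elements C) ⊎ length (elements A) + length (elements B) ≤ length (elements C) + (1 ⊔ 3 * s))
        (length-elements S) bound))
  where
  open GroupBounds G
  open PrimeFactorisation (factorise n {{Fin.nonZeroIndex a}})
  C : Subset n
  C = restrictedSumset G A B S
  cover : Cover (elements A) (elements B) (elements S) (elements C)
  cover {a} {b} a∈ b∈ with (FiniteAbelianGroup._-_ G a b) ∈? S
  ... | yes ∈S = inj₁ (∈-elements ∈S)
  ... | no ∉S  = inj₂ (∈-elements (∈-restrictedSumset G (elements-∈ a∈) (elements-∈ b∈) ∉S))
  nonempty : ∀ (X : Subset n) {x} → x Subset.∈ X → 0 < length (elements X)
  nonempty X x∈ = ∈-length (∈-elements x∈)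
  positive : ∀ (X : Subset n) {x} → x Subset.∈ X → 0 < ∣ X ∣
  positive X x∈ = subst (0 <_) (length-elements X) (nonempty X x∈)
  bound : p ≤ length (elements C) ⊎
    length (elements A) + length (elements B) ≤ length (elements C) + (1 ⊔ 3 * length (elements S))
  -- For p = 2 a factor ℤ/2, where 1 + 1 = 0, may occur in the chain; the target 2 is low enough for
  -- plain counting.
  bound with p ℕ.≟ 2
  ... | yes refl = small-bound (nonempty S s∈S)
    (cover-boundˡ cover (elements-unique A) (nonempty B b∈B))
    (cover-boundʳ cover (elements-unique B) (nonempty A a∈A))
  ... | no p≢2 = cover-size-bound
    (ℕ.≤∧≢⇒< (ℕ.nonTrivial⇒n>1 p {{prime⇒nonTrivial p-prime}}) (p≢2 ∘ sym)) factors factorsPrime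
    (All.tabulate λ q∈ → p-least _ (All.lookup factorsPrime q∈) (subst (_ ∣_) (sym isFactorisation) (∈⇒∣product q∈)))
    (sym isFactorisation) (elements-unique A) (elements-unique B) (nonempty A a∈A) (nonempty B b∈B) cover
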